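{- Let $G$ be a disjoint union of $n\ge 0$ loops of even lengths $\ell_1,\dots,\ell_n\ge4$. Put $c=cv(G)$, i.e. $c=8+\sum_{i=1}^n(\ell_i-8)$ if $n\ge1$ and $c=0$ if $G$ is empty. Let $f$ be the number of 4-loops in $G$. (a) If $\ell_i\ge 8$ for all $i$ then $v(G)=c$. (b) If $c\ge 2$ or $G$ is empty then $v(G)=c$. (c) If $c\le 0$, $f=0$ and $G$ is non-empty, then $v(G)\in\{2,4\}$ and $v(G)\equiv c\pmod 4$. (d) If $c\le 0$ and $f\ge 1$, let $K$ denote $G$ with all its 4-loops removed. If $v(K)\equiv 2\pmod 4$ then $v(G)=2$. Otherwise $v(G)\in\{0,4\}$ and $v(G)\equiv v(K)+4f\pmod 8$.
   Context: Game. A dots and boxes game (position) $G$ consists of a finite set of unclaimed boxes and a finite set of undrawn lines, each undrawn line bordering either exactly one box or exactly two distinct boxes, each box being bordered by at least one and at most four undrawn lines. Two players play. The player to move draws (removes) an undrawn line; every box none of whose bordering lines is still undrawn is then claimed by that player. If the move claims at least one box the same player must move again (if a line remains); otherwise the other player moves. Claiming a box when possible is not compulsory. The game ends when no line remains. Each player maximises (own boxes) minus (opponent's boxes), counting only boxes claimed from $G$ onwards. Value. $v(G)$ is the net score, under optimal play, of the player who is NOT to move in $G$. Equivalently, $v(G)=0$ if $G$ has no undrawn lines, and otherwise $v(G)=\min_m v(G;m)$ over undrawn lines $m$, where, if drawing $m$ claims $k$ boxes and leaves the position $G_m$, then $v(G;m)=v(G_m)-k$ if $k\ge1$ and $v(G;m)=-v(G_m)$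 if $k=0$. Loops. An $n$-loop (loop of length $n\ge4$), denoted $n_\ell$, is the position with boxes $b_1,\dots,b_n$ and lines $e_1,\dots,e_n$, where $e_i$ borders $b_i$ and $b_{i+1}$ (indices mod $n$). -}

module Defs where

open import Data.Fin.Base using (Fin; zero; suc; toℕ; _↑ˡ_; _↑ʳ_; splitAt; join)
import Data.Fin.Properties as Fin
open import Data.Integer.Base using (ℤ; +_; -_; 0ℤ; _-_; _⊓_)
  renaming (_+_ to _+ℤ_)
open import Data.Integer.Divisibility using () renaming (_∣_ to _∣ℤ_)
open import Data.List.Base using (List; []; _∷_; map; foldr; filter)
import Data.List.Base as List
open import Data.Nat.Base
  using (ℕ; zero; suc; _+_; _≤_; _<_; z≤n; s≤s; NonZero; >-nonZero)
open import Data.Nat.DivMod using (_mod_; _%_; m<n⇒m%n≡m; n%n≡0)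
import Data.Nat.Properties as ℕ
open import Data.Product.Base using (_×_; _,_)
open import Data.Sum.Base using (_⊎_; inj₁; inj₂)
open import Data.Vec.Base as Vec
  using (Vec; []; _∷_; _++_; tabulate; removeAt; count; foldr₁)
open import Data.Vec.Relation.Unary.Any using (Any; any?)
open import Data.Empty using (⊥-elim)
open import Function.Base using (_∘_)
open import Function.Definitions using (Injective)
open import Relation.Binary.PropositionalEquality
open import Relation.Nullary using (¬_; ¬?; yes; no; _×-dec_; _⊎-dec_)
open import Relation.Unary using (Decidable)

infix 4 _≡_[mod_]

_≡_[mod_] : ℤ → ℤ → ℕ → Set
a ≡ b [mod m ] = (+ m) ∣ℤ (a - b)

data Line (k : ℕ) : Set where
  one : Fin k → Line k
  two : (a b : Fin k) → .(a ≢ b) → Line k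

Borders : ∀ {k} → Fin k → Line k → Set
Borders x (one a)     = x ≡ a
Borders x (two a b _) = x ≡ a ⊎ x ≡ b

borders? : ∀ {k} (x : Fin k) → Decidable (Borders x)
borders? x (one a)     = x Fin.≟ a
borders? x (two a b _) = (x Fin.≟ a) ⊎-dec (x Fin.≟ b)

degree : ∀ {k n} → Fin k → Vec (Line k) n → ℕ
degree x = count (borders? x)

-- During play the set of box names stays fixed and only the vector of
-- undrawn lines shrinks.  A box is unclaimed as long as some undrawn line
-- borders it; names bordered by no undrawn line are the claimed boxes.

Unclaimed : ∀ {k n} → Vec (Line k) n → Fin k → Set
Unclaimed ls x = Any (Borders x) ls

unclaimed? : ∀ {k n} (ls : Vec (Line k) n) → Decidable (Unclaimed ls)
unclaimed? ls x = any? (borders? x) ls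

claimed : ∀ {k n} → Vec (Line k) (suc n) → Fin (suc n) → ℕ
claimed {k} ls m =
  count (λ x → unclaimed? ls x ×-dec ¬? (unclaimed? (removeAt ls m) x))
        (Vec.allFin k)

-- All values are net scores for the player who is not to move.  Below, w is
-- the value of the position left by a move claiming the given number of
-- boxes: after a claim the same player moves again, so w keeps its sign.
moveValue : ℕ → ℤ → ℤ
moveValue zero    w = - w
moveValue (suc j) w = w - + suc j

value : ∀ {k} n → Vec (Line k) n → ℤ
value zero    ls = 0ℤ
value (suc n) ls =
  foldr₁ _⊓_ (tabulate λ m → moveValue (claimed ls m) (value n (removeAt ls m)))

record Game : Set where
  field
    boxes    : ℕ
    size     : ℕ
    lines    : Vec (Line boxes) size
    bordered : ∀ x → 1 ≤ degree x lines × degree x lines ≤ 4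

v : Game → ℤ
v G = value (Game.size G) (Game.lines G)

emptyGame : Game
emptyGame = record { boxes = 0 ; size = 0 ; lines = [] ; bordered = λ () }

private
  variable
    A B : Set
    k l n : ℕ

count-++ : {P : A → Set} (P? : Decidable P) (xs : Vec A k) (ys : Vec A n) →
           count P? (xs ++ ys) ≡ count P? xs + count P? ys
count-++ P? []       ys = refl
count-++ P? (x ∷ xs) ys with P? x
... | yes _ = cong suc (count-++ P? xs ys)
... | no  _ = count-++ P? xs ys

count-map : {P : A → Set} {Q : B → Set} (P? : Decidable P) (Q? : Decidable Q)
            (f : A → B) → (∀ x → P x → Q (f x)) → (∀ x → Q (f x) → P x) →
            (xs : Vec A n) → count Q? (Vec.map f xs) ≡ count P? xs
count-map P? Q? f to from [] = refl
count-map P? Q? f to from (x ∷ xs) with P? x | Q? (f x)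
... | yes _ | yes _ = cong suc (count-map P? Q? f to from xs)
... | no  _ | no  _ = count-map P? Q? f to from xs
... | yes p | no ¬q = ⊥-elim (¬q (to x p))
... | no ¬p | yes q = ⊥-elim (¬p (from x q))

count-none : {Q : B → Set} (Q? : Decidable Q) (f : A → B) → (∀ x → ¬ Q (f x)) →
             (xs : Vec A n) → count Q? (Vec.map f xs) ≡ 0
count-none Q? f none [] = refl
count-none Q? f none (x ∷ xs) with Q? (f x)
... | yes q = ⊥-elim (none x q)
... | no  _ = count-none Q? f none xs

count-tabulate-≥1 : {P : A → Set} (P? : Decidable P) (f : Fin n → A) (i : Fin n) →
                    P (f i) → 1 ≤ count P? (tabulate f)
count-tabulate-≥1 P? f zero p with P? (f zero)
... | yes _ = s≤s z≤n
... | no ¬p = ⊥-elim (¬p p)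
count-tabulate-≥1 P? f (suc i) p with P? (f zero)
... | yes _ = s≤s z≤n
... | no  _ = count-tabulate-≥1 P? (f ∘ suc) i p

count-tabulate-none : {P : A → Set} (P? : Decidable P) (f : Fin n → A) →
                      (∀ i → ¬ P (f i)) → count P? (tabulate f) ≡ 0
count-tabulate-none {n = zero}  P? f none = refl
count-tabulate-none {n = suc n} P? f none with P? (f zero)
... | yes p = ⊥-elim (none zero p)
... | no  _ = count-tabulate-none P? (f ∘ suc) (none ∘ suc)

count-injective : (x : Fin k) (f : Fin n → Fin k) → Injective _≡_ _≡_ f →
                  count (x Fin.≟_) (tabulate f) ≤ 1
count-injective {n = zero}  x f inj = z≤n
count-injective {n = suc n} x f inj with x Fin.≟ f zero
... | yes p = s≤s (ℕ.≤-reflexive (count-tabulate-none (x Fin.≟_) (f ∘ suc)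
                λ i q → Fin.0≢1+n (inj (trans (sym p) q))))
... | no  _ = count-injective x (f ∘ suc) (Fin.suc-injective ∘ inj)

count-ends : {P : A → Set} (P? : Decidable P) (x : Fin k)
             (f : Fin n → A) (g h : Fin n → Fin k) →
             (∀ i → P (f i) → x ≡ g i ⊎ x ≡ h i) →
             count P? (tabulate f)
               ≤ count (x Fin.≟_) (tabulate g) + count (x Fin.≟_) (tabulate h)
count-ends {n = zero}  P? x f g h split = z≤n
count-ends {n = suc n} P? x f g h split
  with P? (f zero) | x Fin.≟ g zero | x Fin.≟ h zero
     | count-ends P? x (f ∘ suc) (g ∘ suc) (h ∘ suc) (split ∘ suc)
... | no  _ | no  _ | no  _ | r = r
... | no  _ | no  _ | yes _ | r = ℕ.≤-trans r (ℕ.+-monoʳ-≤ _ (ℕ.n≤1+n _))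
... | no  _ | yes _ | no  _ | r = ℕ.m≤n⇒m≤1+n r
... | no  _ | yes _ | yes _ | r = ℕ.m≤n⇒m≤1+n (ℕ.≤-trans r (ℕ.+-monoʳ-≤ _ (ℕ.n≤1+n _)))
... | yes _ | yes _ | no  _ | r = s≤s r
... | yes _ | yes _ | yes _ | r = s≤s (ℕ.≤-trans r (ℕ.+-monoʳ-≤ _ (ℕ.n≤1+n _)))
... | yes _ | no  _ | yes _ | r = ℕ.≤-trans (s≤s r) (ℕ.≤-reflexive (sym (ℕ.+-suc _ _)))
... | yes p | no ¬a | no ¬b | r with split zero p
...   | inj₁ a = ⊥-elim (¬a a)
...   | inj₂ b = ⊥-elim (¬b b)

renameˡ : ∀ l → Line k → Line (k + l)
renameˡ l (one a)         = one (a ↑ˡ l)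
renameˡ l (two a b a≢b)   = two (a ↑ˡ l) (b ↑ˡ l) (λ e → a≢b (Fin.↑ˡ-injective l a b e))

renameʳ : ∀ k → Line l → Line (k + l)
renameʳ k (one a)         = one (k ↑ʳ a)
renameʳ k (two a b a≢b)   = two (k ↑ʳ a) (k ↑ʳ b) (λ e → a≢b (Fin.↑ʳ-injective k a b e))

private
  ↑ˡ≢↑ʳ : (a : Fin k) (b : Fin l) → a ↑ˡ l ≢ k ↑ʳ b
  ↑ˡ≢↑ʳ {k} {l} a b e
    with trans (sym (Fin.splitAt-↑ˡ k a l)) (trans (cong (splitAt k) e) (Fin.splitAt-↑ʳ k l b))
  ... | ()

  borders-ˡ : (x : Fin k) (e : Line k) → Borders x e → Borders (x ↑ˡ l) (renameˡ l e)
  borders-ˡ x (one a)     p        = cong (_↑ˡ _) p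
  borders-ˡ x (two a b _) (inj₁ p) = inj₁ (cong (_↑ˡ _) p)
  borders-ˡ x (two a b _) (inj₂ p) = inj₂ (cong (_↑ˡ _) p)

  borders-ˡ⁻ : (x : Fin k) (e : Line k) → Borders (x ↑ˡ l) (renameˡ l e) → Borders x e
  borders-ˡ⁻ x (one a)     p        = Fin.↑ˡ-injective _ x a p
  borders-ˡ⁻ x (two a b _) (inj₁ p) = inj₁ (Fin.↑ˡ-injective _ x a p)
  borders-ˡ⁻ x (two a b _) (inj₂ p) = inj₂ (Fin.↑ˡ-injective _ x b p)

  borders-ʳ : (x : Fin l) (e : Line l) → Borders x e → Borders (k ↑ʳ x) (renameʳ k e)
  borders-ʳ x (one a)     p        = cong (_ ↑ʳ_) p
  borders-ʳ x (two a b _) (inj₁ p) = inj₁ (cong (_ ↑ʳ_) p)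
  borders-ʳ x (two a b _) (inj₂ p) = inj₂ (cong (_ ↑ʳ_) p)

  borders-ʳ⁻ : (x : Fin l) (e : Line l) → Borders (k ↑ʳ x) (renameʳ k e) → Borders x e
  borders-ʳ⁻ x (one a)     p        = Fin.↑ʳ-injective _ x a p
  borders-ʳ⁻ x (two a b _) (inj₁ p) = inj₁ (Fin.↑ʳ-injective _ x a p)
  borders-ʳ⁻ x (two a b _) (inj₂ p) = inj₂ (Fin.↑ʳ-injective _ x b p)

  borders-ˡʳ : (x : Fin k) (e : Line l) → ¬ Borders (x ↑ˡ l) (renameʳ k e)
  borders-ˡʳ x (one a)     p        = ↑ˡ≢↑ʳ x a p
  borders-ˡʳ x (two a b _) (inj₁ p) = ↑ˡ≢↑ʳ x a p
  borders-ˡʳ x (two a b _) (inj₂ p) = ↑ˡ≢↑ʳ x b p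

  borders-ʳˡ : (x : Fin l) (e : Line k) → ¬ Borders (k ↑ʳ x) (renameˡ l e)
  borders-ʳˡ x (one a)     p        = ↑ˡ≢↑ʳ a x (sym p)
  borders-ʳˡ x (two a b _) (inj₁ p) = ↑ˡ≢↑ʳ a x (sym p)
  borders-ʳˡ x (two a b _) (inj₂ p) = ↑ˡ≢↑ʳ b x (sym p)

unionLines : ∀ {k l m n} → Vec (Line k) m → Vec (Line l) n → Vec (Line (k + l)) (m + n)
unionLines {k} {l} xs ys = Vec.map (renameˡ l) xs ++ Vec.map (renameʳ k) ys

degree-unionˡ : ∀ {k l m n} (xs : Vec (Line k) m) (ys : Vec (Line l) n) (x : Fin k) →
                degree (x ↑ˡ l) (unionLines xs ys) ≡ degree x xs
degree-unionˡ {k} {l} xs ys x = begin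
  degree (x ↑ˡ l) (unionLines xs ys)
    ≡⟨ count-++ (borders? (x ↑ˡ l)) (Vec.map (renameˡ l) xs) _ ⟩
  degree (x ↑ˡ l) (Vec.map (renameˡ l) xs) + degree (x ↑ˡ l) (Vec.map (renameʳ k) ys)
    ≡⟨ cong₂ _+_
         (count-map (borders? x) (borders? (x ↑ˡ l)) (renameˡ l) (borders-ˡ x) (borders-ˡ⁻ x) xs)
         (count-none (borders? (x ↑ˡ l)) (renameʳ k) (borders-ˡʳ x) ys) ⟩
  degree x xs + 0
    ≡⟨ ℕ.+-identityʳ _ ⟩
  degree x xs ∎
  where open ≡-Reasoning

degree-unionʳ : ∀ {k l m n} (xs : Vec (Line k) m) (ys : Vec (Line l) n) (x : Fin l) →
                degree (k ↑ʳ x) (unionLines xs ys) ≡ degree x ys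
degree-unionʳ {k} {l} xs ys x = begin
  degree (k ↑ʳ x) (unionLines xs ys)
    ≡⟨ count-++ (borders? (k ↑ʳ x)) (Vec.map (renameˡ l) xs) _ ⟩
  degree (k ↑ʳ x) (Vec.map (renameˡ l) xs) + degree (k ↑ʳ x) (Vec.map (renameʳ k) ys)
    ≡⟨ cong₂ _+_
         (count-none (borders? (k ↑ʳ x)) (renameˡ l) (borders-ʳˡ x) xs)
         (count-map (borders? x) (borders? (k ↑ʳ x)) (renameʳ k) (borders-ʳ x) (borders-ʳ⁻ x) ys) ⟩
  degree x ys ∎
  where open ≡-Reasoning

infixr 6 _⊕_

_⊕_ : Game → Game → Game
G ⊕ H = record
  { boxes    = G.boxes + H.boxes
  ; size     = G.size + H.size
  ; lines    = unionLines G.lines H.lines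
  ; bordered = λ x → subst Bounded (Fin.join-splitAt G.boxes H.boxes x) (bounded (splitAt G.boxes x))
  }
  where
  module G = Game G
  module H = Game H

  Bounded : Fin (G.boxes + H.boxes) → Set
  Bounded x = 1 ≤ degree x (unionLines G.lines H.lines)
            × degree x (unionLines G.lines H.lines) ≤ 4

  bounded : (s : Fin G.boxes ⊎ Fin H.boxes) → Bounded (join G.boxes H.boxes s)
  bounded (inj₁ x) rewrite degree-unionˡ G.lines H.lines x = G.bordered x
  bounded (inj₂ x) rewrite degree-unionʳ G.lines H.lines x = H.bordered x

record Loop : Set where
  constructor mkLoop
  field
    length   : ℕ
    4≤length : 4 ≤ length

open Loop public

next : .{{_ : NonZero n}} → Fin n → Fin n
next {n} i = suc (toℕ i) mod n

private
  toℕ-next : .{{_ : NonZero n}} (i : Fin n) →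
             (toℕ (next i) ≡ suc (toℕ i) × suc (toℕ i) < n)
             ⊎ (toℕ (next i) ≡ 0 × suc (toℕ i) ≡ n)
  toℕ-next {n} i with suc (toℕ i) ℕ.<? n
  ... | yes lt = inj₁ (trans (Fin.toℕ-fromℕ< _) (m<n⇒m%n≡m lt) , lt)
  ... | no ¬lt = inj₂ (trans (Fin.toℕ-fromℕ< _) (trans (cong (_% n) eq) (n%n≡0 n)) , eq)
    where eq = ℕ.≤-antisym (Fin.toℕ<n i) (ℕ.≮⇒≥ ¬lt)

next-injective : .{{_ : NonZero n}} → Injective _≡_ _≡_ (next {n})
next-injective {n} {x = i} {y = j} e with toℕ-next i | toℕ-next j
... | inj₁ (p , _) | inj₁ (q , _) =
        Fin.toℕ-injective (ℕ.suc-injective (trans (sym p) (trans (cong toℕ e) q)))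
... | inj₂ (_ , p) | inj₂ (_ , q) =
        Fin.toℕ-injective (ℕ.suc-injective (trans p (sym q)))
... | inj₁ (p , _) | inj₂ (q , _) =
        ⊥-elim (ℕ.1+n≢0 (trans (sym p) (trans (cong toℕ e) q)))
... | inj₂ (p , _) | inj₁ (q , _) =
        ⊥-elim (ℕ.1+n≢0 (trans (sym q) (trans (cong toℕ (sym e)) p)))

next-≢ : .{{_ : NonZero n}} → 2 ≤ n → (i : Fin n) → i ≢ next i
next-≢ 2≤n i e with toℕ-next i
... | inj₁ (p , _) = ℕ.1+n≢n (trans (sym p) (cong toℕ (sym e)))
... | inj₂ (p , q) with trans (cong suc (trans (sym p) (cong toℕ (sym e)))) q
...   | refl = ℕ.<⇒≱ 2≤n (s≤s z≤n)

loopGame : Loop → Game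
loopGame ℓ = record
  { boxes    = length ℓ
  ; size     = length ℓ
  ; lines    = tabulate edge
  ; bordered = λ x → count-tabulate-≥1 (borders? x) edge x (inj₁ refl)
                   , ℕ.≤-trans (count-ends (borders? x) x edge (λ i → i) next (λ _ p → p))
                       (ℕ.≤-trans (ℕ.+-mono-≤ (count-injective x (λ i → i) (λ e → e))
                                              (count-injective x next next-injective))
                                  (s≤s (s≤s z≤n)))
  }
  where
  instance
    length-nonZero : NonZero (length ℓ)
    length-nonZero = >-nonZero (ℕ.≤-trans (s≤s z≤n) (4≤length ℓ))

  edge : Fin (length ℓ) → Line (length ℓ)
  edge i = two i (next i) (next-≢ (ℕ.≤-trans (s≤s (s≤s z≤n)) (4≤length ℓ)) i)

loops : List Loop → Game
loops ℓs = foldr _⊕_ emptyGame (map loopGame ℓs)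

-- The controlled value.
cv : List Loop → ℤ
cv []         = 0ℤ
cv ℓs@(_ ∷ _) = + 8 +ℤ foldr _+ℤ_ 0ℤ (map (λ ℓ → + length ℓ - + 8) ℓs)

fourLoops : List Loop → ℕ
fourLoops ℓs = List.length (filter (λ ℓ → length ℓ ℕ.≟ 4) ℓs)

removeFourLoops : List Loop → List Loop
removeFourLoops = filter (λ ℓ → ¬? (length ℓ ℕ.≟ 4))

{-# OPTIONS --safe #-}
module Submission where

-- Opening an ℓ-loop beside loops of total value x hands the opponent a path of ℓ boxes, of
-- which the opponent either takes everything, for a net ℓ − x, or all but two dominoes that
-- the opener then takes, for a net ℓ − 8 + x; nothing else is better.  Hence
-- v(G) = min over the loops of max (ℓ − x, ℓ − 8 + x) = ℓ − 4 + |x − 4| with x = v(G ∖ ℓ),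
-- and everything follows from this recursion by induction on the number of loops:
-- always v ≥ c and v ≡ c (mod 4); removing a suitable loop gives v ≤ c when c ≥ 2, and
-- v ≤ 4 when c ≤ 0; in the latter case, if v is a multiple of 4, removing a 4-loop exchanges the
-- values 0 and 4.

open import Defs
open import Data.Empty using (⊥-elim; ⊥-elim-irr)
open import Data.Fin.Base using (Fin; zero; suc; _↑ˡ_; _↑ʳ_; splitAt; toℕ; inject₁; fromℕ)
import Data.Fin.Properties as Fin
open import Data.Integer.Base
  using (ℤ; +_; -[1+_]; -_; _-_; 0ℤ; _≤_; _+_; _*_; _⊓_; _⊔_; +≤+; -≤+)
open import Data.Integer.Divisibility.Signed
  using (_∣_; divides; _∣?_; ∣ᵤ⇒∣; ∣⇒∣ᵤ; ∣m∣n⇒∣m+n; ∣m∣n⇒∣m-n; ∣m⇒∣-m; *-monoʳ-∣; ∣-trans)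
open import Data.Integer.DivMod using (_%ℕ_; _/ℕ_; a≡a%ℕn+[a/ℕn]*n; n%ℕd<d)
import Data.Integer.Properties as ℤ
open import Data.Integer.Tactic.RingSolver using (solve-∀)
open import Data.List.Base using (List; []; _∷_; _++_; [_]; concat; concatMap; initLast; _∷ʳ′_)
import Data.List.Base as List
import Data.List.Properties as List
open import Data.List.Membership.Propositional using (_∈_; find)
open import Data.List.Membership.Propositional.Properties
  using (∈-∃++; ∈-++⁻; ∈-++⁺ˡ; ∈-++⁺ʳ; ∈-map⁻)
open import Data.List.Relation.Binary.Permutation.Propositional
  using (_↭_; prep; swap; ↭-refl; ↭-sym; ↭-trans; ↭-reflexive; ↭⇒↭ₛ; module PermutationReasoning)
open import Data.List.Relation.Binary.Permutation.Propositional.Properties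
  using (Any-resp-↭; All-resp-↭; ∈-resp-↭; ↭-length; drop-∷; shift; ++⁺ˡ; ++⁺ʳ; ++-comm)
import Data.List.Relation.Binary.Permutation.Setoid.Properties as Permutation
open import Data.List.Relation.Unary.All as All using (All; []; _∷_)
import Data.List.Relation.Unary.All.Properties as All
open import Data.List.Relation.Unary.AllPairs using ([]; _∷_)
open import Data.List.Relation.Unary.Any using (Any; here; there; any?)
import Data.List.Relation.Unary.Any.Properties as Any
open import Data.List.Relation.Unary.Unique.Propositional using (Unique)
import Data.List.Relation.Unary.Unique.Propositional.Properties as Unique
open import Data.Nat.Base as ℕ using (ℕ; zero; suc; s≤s; z≤n)
import Data.Nat.Divisibility as ℕ
open import Data.Nat.DivMod using (m<n⇒m%n≡m; n%n≡0)
import Data.Nat.Properties as ℕ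
open import Data.Product.Base using (_×_; _,_; proj₁; proj₂; ∃; ∃₂)
open import Data.Sum.Base as Sum using (_⊎_; inj₁; inj₂)
open import Data.Vec.Base as Vec
  using (Vec; []; _∷_; toList; removeAt; lookup; count; foldr₁; tabulate)
import Data.Vec.Properties as Vec
import Data.Vec.Relation.Unary.Any.Properties as VecAny
open import Function.Base using (_∘_; id; case_of_)
open import Relation.Binary.PropositionalEquality hiding ([_])
open import Relation.Nullary using (¬_; ¬?; Dec; yes; no; contradiction; from-no; _×-dec_; _⊎-dec_)
open import Relation.Unary using (Decidable)

-- The delicate claim is that nothing beats the two plans. The controller may also draw a line
-- elsewhere or cut the path in the middle, and for the resulting positions with several damaged
-- components no formula is derived. None is needed: such a move claims nothing, and if the other
-- player just takes every box of the path pieces, the move is already no better than one of the two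
-- plans. So the induction runs over one path beside a fixed rest `H`, of which only one property
-- matters: no first move in `H` claims a box (`Quiet`).
--
-- The 8 is twice four: double-dealing turns four boxes from a gain into a loss, in exchange for the
-- opponent having to move in the rest. The 4 is the break-even point, since both plans yield ℓ - 4
-- at x = 4.
--
-- The value is defined on vectors of lines over box names that persist after claiming, whereas the
-- recursion speaks of lists of lengths. Two invariances bridge the gap: permuting the lines, and
-- exchanging a family of disjoint cycles for another with the same lengths.

private
  variable
    k l n n′ : ℕ

-- Counting, minima and removal from vectors

count-⇔ : {A : Set} {P Q : A → Set} (P? : Decidable P) (Q? : Decidable Q) →
          (∀ x → P x → Q x) → (∀ x → Q x → P x) →
          (xs : Vec A n) → count P? xs ≡ count Q? xs
count-⇔ P? Q? to from xs =
  trans (cong (count P?) (sym (Vec.map-id xs))) (count-map Q? P? id from to xs)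

count-⊎ : {A : Set} {P Q : A → Set} (P? : Decidable P) (Q? : Decidable Q) →
          (∀ x → P x → ¬ Q x) → (xs : Vec A n) →
          count (λ x → P? x ⊎-dec Q? x) xs ≡ count P? xs ℕ.+ count Q? xs
count-⊎ P? Q? disjoint [] = refl
count-⊎ P? Q? disjoint (x ∷ xs) with P? x | Q? x
... | yes p | yes q = ⊥-elim (disjoint x p q)
... | yes _ | no _  = cong suc (count-⊎ P? Q? disjoint xs)
... | no _  | yes _ = trans (cong suc (count-⊎ P? Q? disjoint xs)) (sym (ℕ.+-suc _ _))
... | no _  | no _  = count-⊎ P? Q? disjoint xs

count-singleton : (a : Fin k) → count (a Fin.≟_) (Vec.allFin k) ≡ 1
count-singleton a =
  ℕ.≤-antisym (count-injective a id id) (count-tabulate-≥1 (a Fin.≟_) id a refl)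

foldr₁-⊓-≤ : (g : Fin (suc n) → ℤ) (m : Fin (suc n)) → foldr₁ _⊓_ (tabulate g) ≤ g m
foldr₁-⊓-≤ {n = zero}  g zero    = ℤ.≤-refl
foldr₁-⊓-≤ {n = suc n} g zero    = ℤ.i⊓j≤i _ _
foldr₁-⊓-≤ {n = suc n} g (suc m) = ℤ.≤-trans (ℤ.i⊓j≤j (g zero) _) (foldr₁-⊓-≤ (g ∘ suc) m)

foldr₁-⊓-attained : (g : Fin (suc n) → ℤ) → ∃ λ m → foldr₁ _⊓_ (tabulate g) ≡ g m
foldr₁-⊓-attained {n = zero}  g = zero , refl
foldr₁-⊓-attained {n = suc n} g with ℤ.⊓-sel (g zero) (foldr₁ _⊓_ (tabulate (g ∘ suc)))
... | inj₁ e = zero , e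
... | inj₂ e with foldr₁-⊓-attained (g ∘ suc)
...   | m , e′ = suc m , trans e e′

↭-removeAt : {A : Set} (xs : Vec A (suc n)) (m : Fin (suc n)) →
             toList xs ↭ lookup xs m ∷ toList (removeAt xs m)
↭-removeAt (x ∷ xs)         zero    = ↭-refl
↭-removeAt (x ∷ xs@(_ ∷ _)) (suc m) = ↭-trans (prep x (↭-removeAt xs m)) (swap x _ ↭-refl)

index-of : {A : Set} {x : A} (xs : Vec A n) → x ∈ toList xs → ∃ λ m → lookup xs m ≡ x
index-of (x ∷ xs) (here refl) = zero , refl
index-of (x ∷ xs) (there x∈xs) with index-of xs x∈xs
... | m , e = suc m , e

-- Positions as lists of undrawn lines up to permutation

Alive : List (Line k) → Fin k → Set
Alive L x = Any (Borders x) L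

alive? : (L : List (Line k)) → Decidable (Alive L)
alive? L x = any? (borders? x) L

Claimed : Line k → List (Line k) → Fin k → Set
Claimed e L x = Borders x e × ¬ Alive L x

claimed? : (e : Line k) (L : List (Line k)) → Decidable (Claimed e L)
claimed? e L x = borders? x e ×-dec ¬? (alive? L x)

-- The number of boxes claimed by drawing e when L is the list of remaining lines.
claims : Line k → List (Line k) → ℕ
claims {k} e L = count (claimed? e L) (Vec.allFin k)

claims-↭ : (e : Line k) {L L′ : List (Line k)} → L ↭ L′ → claims e L ≡ claims e L′
claims-↭ e {L} {L′} p = count-⇔ (claimed? e L) (claimed? e L′)
  (λ { x (b , d) → b , d ∘ Any-resp-↭ (↭-sym p) })
  (λ { x (b , d) → b , d ∘ Any-resp-↭ p }) (Vec.allFin _)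

-- A box that is unclaimed before a move and claimed after it must border the line drawn, so the
-- count depends only on that line and the remaining ones.
claimed≡claims : (ls : Vec (Line k) (suc n)) (m : Fin (suc n)) →
                 claimed ls m ≡ claims (lookup ls m) (toList (removeAt ls m))
claimed≡claims ls m =
  count-⇔ (λ x → unclaimed? ls x ×-dec ¬? (unclaimed? (removeAt ls m) x))
          (claimed? (lookup ls m) (toList (removeAt ls m))) to from (Vec.allFin _)
  where
  to : ∀ x → Unclaimed ls x × ¬ Unclaimed (removeAt ls m) x →
       Borders x (lookup ls m) × ¬ Alive (toList (removeAt ls m)) x
  to x (a , d) with Any-resp-↭ (↭-removeAt ls m) (VecAny.toList⁺ a)
  ... | here b  = b , d ∘ VecAny.toList⁻
  ... | there a = ⊥-elim (d (VecAny.toList⁻ a))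

  from : ∀ x → Borders x (lookup ls m) × ¬ Alive (toList (removeAt ls m)) x →
         Unclaimed ls x × ¬ Unclaimed (removeAt ls m) x
  from x (b , d) = VecAny.toList⁻ (Any-resp-↭ (↭-sym (↭-removeAt ls m)) (here b)) , d ∘ VecAny.toList⁺

option : Vec (Line k) (suc n) → Fin (suc n) → ℤ
option ls m = moveValue (claimed ls m) (value _ (removeAt ls m))

-- Each move in one position is matched with the move that draws the same line in the other; the
-- remaining lines are again permutations of each other.
value-↭ : (ls : Vec (Line k) n) (ls′ : Vec (Line k) n′) → toList ls ↭ toList ls′ →
          value n ls ≡ value n′ ls′
value-↭ []       []       p = refl
value-↭ []       (_ ∷ _)  p = case ↭-length p of λ ()
value-↭ (_ ∷ _)  []       p = case ↭-length p of λ ()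
value-↭ {n = suc n} {n′ = suc n′} ls@(_ ∷ _) ls′@(_ ∷ _) p =
  ℤ.≤-antisym (bound ls ls′ p (λ m m′ → value-↭ (removeAt ls m) (removeAt ls′ m′)))
              (bound ls′ ls (↭-sym p) (λ m′ m q → sym (value-↭ (removeAt ls m) (removeAt ls′ m′) (↭-sym q))))
  where
  -- The equality of the smaller values is a hypothesis here, so that one argument serves both
  -- inequalities; the second use swaps the lists and flips the recursive call.
  bound : ∀ {n n′} (ls : Vec (Line _) (suc n)) (ls′ : Vec (Line _) (suc n′)) → toList ls ↭ toList ls′ →
          (∀ m m′ → toList (removeAt ls m) ↭ toList (removeAt ls′ m′) →
             value n (removeAt ls m) ≡ value n′ (removeAt ls′ m′)) →
          value (suc n) ls ≤ value (suc n′) ls′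
  bound ls ls′ p equal
    with m′ , attained ← foldr₁-⊓-attained (option ls′)
    with m , e ← index-of ls (∈-resp-↭ (↭-sym (↭-trans p (↭-removeAt ls′ m′))) (here refl)) =
    ℤ.≤-trans (foldr₁-⊓-≤ (option ls) m) (ℤ.≤-reflexive (sym (trans attained (cong₂ moveValue claimed-eq (sym (equal m m′ rest))))))
    where
    rest : toList (removeAt ls m) ↭ toList (removeAt ls′ m′)
    rest = drop-∷ (↭-trans (↭-sym (subst (λ x → toList ls ↭ x ∷ _) e (↭-removeAt ls m)))
                           (↭-trans p (↭-removeAt ls′ m′)))

    claimed-eq : claimed ls′ m′ ≡ claimed ls m
    claimed-eq = begin
      claimed ls′ m′                                         ≡⟨ claimed≡claims ls′ m′ ⟩
      claims (lookup ls′ m′) (toList (removeAt ls′ m′))      ≡⟨ cong (λ x → claims x _) e ⟨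
      claims (lookup ls m) (toList (removeAt ls′ m′))        ≡⟨ claims-↭ (lookup ls m) rest ⟨
      claims (lookup ls m) (toList (removeAt ls m))          ≡⟨ claimed≡claims ls m ⟨
      claimed ls m                                           ∎
      where open ≡-Reasoning

abstract
  -- Opaque outside this block: the game is used only through agreement with `value`, invariance
  -- under permutation, and the fact that `V` is the minimum over first moves.
  V : List (Line k) → ℤ
  V L = value (List.length L) (Vec.fromList L)

  value≡V : (ls : Vec (Line k) n) → value n ls ≡ V (toList ls)
  value≡V ls = value-↭ ls _ (↭-reflexive (sym (Vec.toList∘fromList (toList ls))))

  V-↭ : {L L′ : List (Line k)} → L ↭ L′ → V L ≡ V L′
  V-↭ {L = L} {L′} p = value-↭ (Vec.fromList L) (Vec.fromList L′)
    (subst₂ _↭_ (sym (Vec.toList∘fromList L)) (sym (Vec.toList∘fromList L′)) p)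

  V-≤ : {L L′ : List (Line k)} {e : Line k} → L ↭ e ∷ L′ →
        V L ≤ moveValue (claims e L′) (V L′)
  V-≤ {L = L} {L′} {e} p = begin
    V L                                                       ≡⟨ V-↭ p ⟩
    V (e ∷ L′)                                                ≤⟨ foldr₁-⊓-≤ (option (Vec.fromList (e ∷ L′))) zero ⟩
    moveValue (claimed (Vec.fromList (e ∷ L′)) zero) (V L′)   ≡⟨ cong (λ j → moveValue j (V L′)) (claimed≡claims (Vec.fromList (e ∷ L′)) zero) ⟩
    moveValue (claims e (toList (Vec.fromList L′))) (V L′)    ≡⟨ cong (λ M → moveValue (claims e M) (V L′)) (Vec.toList∘fromList L′) ⟩
    moveValue (claims e L′) (V L′)                            ∎
    where open ℤ.≤-Reasoning

  V-attained : (e : Line k) (L : List (Line k)) →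
               ∃₂ λ e′ L′ → e ∷ L ↭ e′ ∷ L′ × V (e ∷ L) ≡ moveValue (claims e′ L′) (V L′)
  V-attained {k} e L =
    lookup ls m , toList (removeAt ls m)
    , subst (_↭ lookup ls m ∷ toList (removeAt ls m)) (Vec.toList∘fromList (e ∷ L)) (↭-removeAt ls m)
    , trans eq (cong₂ moveValue (claimed≡claims ls m) (value≡V (removeAt ls m)))
    where
    ls : Vec (Line k) (List.length (e ∷ L))
    ls = Vec.fromList (e ∷ L)

    m : Fin (List.length (e ∷ L))
    m = proj₁ (foldr₁-⊓-attained (option ls))

    eq : V (e ∷ L) ≡ option ls m
    eq = proj₂ (foldr₁-⊓-attained (option ls))

V-attained-≢[] : {L : List (Line k)} → L ≢ [] →
             ∃₂ λ e′ L′ → L ↭ e′ ∷ L′ × V L ≡ moveValue (claims e′ L′) (V L′)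
V-attained-≢[] {L = []}    ne = ⊥-elim (ne refl)
V-attained-≢[] {L = e ∷ L} ne = V-attained e L

-- Reduces a linear inequality to a known one (often a sum of several): the two gaps agree by a ring
-- identity.
≤-by-difference : ∀ {a b x y} → x ≤ y → b - a ≡ y - x → a ≤ b
≤-by-difference x≤y e = ℤ.0≤i-j⇒j≤i (subst (0ℤ ≤_) (sym e) (ℤ.i≤j⇒0≤j-i x≤y))

-- How many boxes one line claims

module _ {e : Line k} {L : List (Line k)} where

  claims≡0 : (∀ x → Borders x e → Alive L x) → claims e L ≡ 0
  claims≡0 alive = count-tabulate-none (claimed? e L) id λ { x (b , d) → d (alive x b) }

  claims≡1 : ∀ a → Claimed e L a → (∀ x → Claimed e L x → a ≡ x) → claims e L ≡ 1
  claims≡1 a c unique = trans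
    (count-⇔ (claimed? e L) (a Fin.≟_) unique (λ { x refl → c }) (Vec.allFin k))
    (count-singleton a)

  claims≡2 : ∀ {a b} → a ≢ b → Claimed e L a → Claimed e L b →
             (∀ x → Claimed e L x → a ≡ x ⊎ b ≡ x) → claims e L ≡ 2
  claims≡2 {a} {b} a≢b ca cb only = begin
    claims e L
      ≡⟨ count-⇔ (claimed? e L) (λ x → (a Fin.≟ x) ⊎-dec (b Fin.≟ x)) only
           (λ { x (inj₁ refl) → ca ; x (inj₂ refl) → cb }) (Vec.allFin k) ⟩
    count′ (λ x → (a Fin.≟ x) ⊎-dec (b Fin.≟ x))
      ≡⟨ count-⊎ (a Fin.≟_) (b Fin.≟_) (λ { x refl refl → a≢b refl }) (Vec.allFin k) ⟩
    count′ (a Fin.≟_) ℕ.+ count′ (b Fin.≟_)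
      ≡⟨ cong₂ ℕ._+_ (count-singleton a) (count-singleton b) ⟩
    2 ∎
    where
    open ≡-Reasoning
    count′ : {P : Fin k → Set} → Decidable P → ℕ
    count′ P? = Vec.count P? (Vec.allFin k)

-- Total in both boxes, so that paths and loops can be formed from arbitrary lists of boxes. The
-- default `one a` for equal boxes does not occur on lists of distinct boxes; `line-two` identifies
-- the other branch with the lines of the game.
line : Fin k → Fin k → Line k
line a b with a Fin.≟ b
... | yes _  = one a
... | no a≢b = two a b a≢b

line-two : {a b : Fin k} .(a≢b : a ≢ b) → two a b a≢b ≡ line a b
line-two {a = a} {b} a≢b with a Fin.≟ b
... | yes a≡b = ⊥-elim-irr (a≢b a≡b)
... | no _    = refl

borders-line⁺ : (a b : Fin k) {x : Fin k} → x ≡ a ⊎ x ≡ b → Borders x (line a b)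
borders-line⁺ a b p with a Fin.≟ b
... | yes refl = Sum.reduce p
... | no _     = p

borders-line⁻ : (a b : Fin k) {x : Fin k} → Borders x (line a b) → x ≡ a ⊎ x ≡ b
borders-line⁻ a b p with a Fin.≟ b
... | yes _ = inj₁ p
... | no _  = p

V-≤-claims : ∀ {j} {L L′ : List (Line k)} {e : Line k} → L ↭ e ∷ L′ → claims e L′ ≡ j →
             V L ≤ moveValue j (V L′)
V-≤-claims {L = L} {L′} p c = subst (λ j → V L ≤ moveValue j (V L′)) c (V-≤ p)

∈⇒↭ : {A : Set} {x : A} {xs : List A} → x ∈ xs → ∃ λ ys → xs ↭ x ∷ ys
∈⇒↭ {x = x} x∈xs with ys , zs , refl ← ∈-∃++ x∈xs = ys ++ zs , shift x ys zs

-- Dominoes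

Fresh : List (Line k) → List (Fin k) → Set
Fresh L = All (λ x → ¬ Alive L x)

fresh-↭ : {L L′ : List (Line k)} {e : Line k} {p : List (Fin k)} →
          L ↭ e ∷ L′ → Fresh L p → Fresh L′ p
fresh-↭ q = All.map (λ dead alive → dead (Any-resp-↭ (↭-sym q) (there alive)))

claims-domino : {a b : Fin k} {X : List (Line k)} → a ≢ b → Fresh X (a ∷ b ∷ []) →
                claims (line a b) X ≡ 2
claims-domino {a = a} {b} a≢b (da ∷ db ∷ []) =
  claims≡2 a≢b (borders-line⁺ a b (inj₁ refl) , da) (borders-line⁺ a b (inj₂ refl) , db)
    (λ x c → Sum.map sym sym (borders-line⁻ a b (proj₁ c)))

V-domino-≤ : {a b : Fin k} {X : List (Line k)} → a ≢ b → Fresh X (a ∷ b ∷ []) →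
             V (line a b ∷ X) ≤ V X - + 2
V-domino-≤ {X = X} a≢b fresh =
  V-≤-claims ↭-refl (claims-domino a≢b fresh)

-- Delaying a domino never helps. After any other move the domino is, by induction, worth 2 to the
-- next player to move: if the move claimed a box, that is the same player and nothing is lost; if
-- not, the opponent gets the domino.
V-domino-≥ : {a b : Fin k} {X : List (Line k)} → a ≢ b → Fresh X (a ∷ b ∷ []) →
             V X - + 2 ≤ V (line a b ∷ X)
V-domino-≥ {k} {a} {b} {X} a≢b = go (List.length X) X refl
  where
  Goal : List (Line k) → Set
  Goal X = Fresh X (a ∷ b ∷ []) → V X - + 2 ≤ V (line a b ∷ X)

  byMove : ∀ X → (∀ Z → suc (List.length Z) ≡ List.length X → Goal Z) → Goal X
  byMove X hyp fresh with V-attained (line a b) X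
  ... | e , L , p , attained with ∈-resp-↭ p (here refl)
  ...   | here refl = ℤ.≤-reflexive (sym (trans attained
            (cong₂ moveValue (trans (claims-↭ _ (↭-sym X↭L)) (claims-domino a≢b fresh)) (V-↭ (↭-sym X↭L)))))
    where
    X↭L : X ↭ L
    X↭L = drop-∷ p
  ...   | there ab∈L with ∈⇒↭ ab∈L
  ...     | Z , L↭ with drop-∷ (↭-trans p (↭-trans (prep e L↭) (swap e _ ↭-refl)))
  ...       | X↭ = ℤ.≤-trans (compare (claims e Z) (V-≤ X↭))
                  (ℤ.≤-trans (step (claims e Z)) (ℤ.≤-reflexive (sym attained′)))
    where
    rest : V Z - + 2 ≡ V L
    rest = trans (ℤ.≤-antisym (hyp Z (sym (↭-length X↭)) (fresh-↭ X↭ fresh)) (V-domino-≤ a≢b (fresh-↭ X↭ fresh)))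
                 (V-↭ (↭-sym L↭))

    -- `e` comes from `X`, which is fresh for `a` and `b`; hence the domino does not affect what `e`
    -- claims.
    untouched : ∀ x → Borders x e → Alive (line a b ∷ Z) x → Alive Z x
    untouched x b (there alive) = alive
    untouched x be (here ab) with borders-line⁻ a b ab
    ... | inj₁ refl = ⊥-elim (All.lookup fresh (here refl) (Any-resp-↭ (↭-sym X↭) (here be)))
    ... | inj₂ refl = ⊥-elim (All.lookup fresh (there (here refl)) (Any-resp-↭ (↭-sym X↭) (here be)))

    claims-eq : claims e L ≡ claims e Z
    claims-eq = trans (claims-↭ e L↭) (count-⇔ (claimed? e (line a b ∷ Z)) (claimed? e Z)
      (λ { x (b , d) → b , d ∘ there }) (λ { x (b , d) → b , d ∘ untouched x b }) (Vec.allFin k))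

    attained′ : V (line a b ∷ X) ≡ moveValue (claims e Z) (V Z - + 2)
    attained′ = trans attained (cong₂ moveValue claims-eq (sym rest))

    compare : ∀ j → V X ≤ moveValue j (V Z) → V X - + 2 ≤ moveValue j (V Z) - + 2
    compare j q = ℤ.+-monoˡ-≤ (- + 2) q

    step : ∀ j → moveValue j (V Z) - + 2 ≤ moveValue j (V Z - + 2)
    -- The slack 4 is the swing between taking the domino and leaving it to the opponent.
    step zero    = ≤-by-difference (+≤+ (z≤n {4})) (identity (V Z))
      where
      identity : ∀ z → (- (z - + 2)) - (- z - + 2) ≡ + 4 - 0ℤ
      identity = solve-∀
    step (suc j) = ℤ.≤-reflexive (identity (V Z) (+ suc j))
      where
      identity : ∀ z y → (z - y) - + 2 ≡ (z - + 2) - y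
      identity = solve-∀

  go : ∀ n (X : List (Line k)) → List.length X ≡ n → Goal X
  go zero    X len = byMove X λ Z e → case trans e len of λ ()
  go (suc n) X len = byMove X λ Z e → go n Z (ℕ.suc-injective (trans e len))

-- Paths: taking all boxes and double-dealing

-- With no lines beyond the two ends, this is what remains of a loop once one of its lines is drawn:
-- each end box has a single undrawn line.
pathLines : List (Fin k) → List (Line k)
pathLines []            = []
pathLines (a ∷ [])      = []
pathLines (a ∷ b ∷ p)   = line a b ∷ pathLines (b ∷ p)

alive-path⁻ : (p : List (Fin k)) {x : Fin k} → Alive (pathLines p) x → x ∈ p
alive-path⁻ (a ∷ b ∷ p) (here e)  = Sum.[ here , there ∘ here ]′ (borders-line⁻ a b e)
alive-path⁻ (a ∷ b ∷ p) (there e) = there (alive-path⁻ (b ∷ p) e)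

alive-path⁺ : (p : List (Fin k)) {x : Fin k} → 2 ℕ.≤ List.length p → x ∈ p → Alive (pathLines p) x
alive-path⁺ (a ∷ b ∷ p)     _ (here e)         = here (borders-line⁺ a b (inj₁ e))
alive-path⁺ (a ∷ b ∷ p)     _ (there (here e)) = here (borders-line⁺ a b (inj₂ e))
alive-path⁺ (a ∷ b ∷ c ∷ p) _ (there (there x∈p)) =
  there (alive-path⁺ (b ∷ c ∷ p) (s≤s (s≤s z≤n)) (there x∈p))
alive-path⁺ (_ ∷ []) (s≤s ())

path-split : (p : List (Fin k)) {e : Line k} → e ∈ pathLines p →
             ∃ λ us → ∃ λ a → ∃ λ b → ∃ λ vs → p ≡ (us ++ [ a ]) ++ b ∷ vs × e ≡ line a b
path-split (a ∷ b ∷ p) (here e) = [] , a , b , p , refl , e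
path-split (a ∷ b ∷ p) (there e∈p) with path-split (b ∷ p) e∈p
... | us , c , d , vs , q , e = a ∷ us , c , d , vs , cong (a ∷_) q , e

pathLines-split : (us : List (Fin k)) (a b : Fin k) (vs : List (Fin k)) →
  pathLines ((us ++ [ a ]) ++ b ∷ vs) ≡ pathLines (us ++ [ a ]) ++ line a b ∷ pathLines (b ∷ vs)
pathLines-split []           a b vs = refl
pathLines-split (u ∷ [])     a b vs = refl
pathLines-split (u ∷ w ∷ us) a b vs = cong (line u w ∷_) (pathLines-split (w ∷ us) a b vs)

unique-++⁻ : {A : Set} (xs : List A) {ys : List A} → Unique (xs ++ ys) →
             Unique xs × Unique ys × (∀ {x} → x ∈ xs → ¬ x ∈ ys)
unique-++⁻ []       u       = [] , u , λ ()
unique-++⁻ (x ∷ xs) (p ∷ u) with unique-++⁻ xs u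
... | ux , uy , disjoint = All.++⁻ˡ xs p ∷ ux , uy , λ
  { (here refl) x∈ys → All.lookup (All.++⁻ʳ xs p) x∈ys refl
  ; (there x∈xs) → disjoint x∈xs }

fresh-++ : {L L′ : List (Line k)} {p : List (Fin k)} → Fresh L p → Fresh L′ p → Fresh (L ++ L′) p
fresh-++ {L = L} f f′ = All.map
  (λ { (d , d′) → Sum.[ d , d′ ] ∘ Any.++⁻ L }) (All.zip (f , f′))

fresh-path : {p q : List (Fin k)} → (∀ {x} → x ∈ p → ¬ x ∈ q) → Fresh (pathLines q) p
fresh-path {q = q} disjoint = All.tabulate λ x∈p alive → disjoint x∈p (alive-path⁻ q alive)

-- The length condition excludes the domino, where the same line claims two boxes.
claims-first : {a b : Fin k} {p : List (Fin k)} {X : List (Line k)} → 2 ℕ.≤ List.length (b ∷ p) →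
               Unique (a ∷ b ∷ p) → Fresh X (a ∷ b ∷ p) →
               claims (line a b) (pathLines (b ∷ p) ++ X) ≡ 1
claims-first {a = a} {b} {p} {X} 2≤ (a∉ ∷ _) (da ∷ _) =
  claims≡1 a (borders-line⁺ a b (inj₁ refl) , Sum.[ dead , da ] ∘ Any.++⁻ (pathLines (b ∷ p)))
    λ x (e , d) → Sum.[ sym , (λ { refl → ⊥-elim (d (Any.++⁺ˡ (alive-path⁺ (b ∷ p) 2≤ (here refl)))) }) ]
                     (borders-line⁻ a b e)
  where
  dead : ¬ Alive (pathLines (b ∷ p)) a
  dead q = All.lookup a∉ (alive-path⁻ (b ∷ p) q) refl

V-takeFirst : (a b c : Fin k) (p : List (Fin k)) (X : List (Line k)) →
              Unique (a ∷ b ∷ c ∷ p) → Fresh X (a ∷ b ∷ c ∷ p) →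
              V (pathLines (a ∷ b ∷ c ∷ p) ++ X) ≤ V (pathLines (b ∷ c ∷ p) ++ X) - + 1
V-takeFirst a b c p X u fresh = V-≤-claims ↭-refl (claims-first (s≤s (s≤s z≤n)) u fresh)

V-takeAll : (p : List (Fin k)) (X : List (Line k)) → 2 ℕ.≤ List.length p → Unique p → Fresh X p →
            V (pathLines p ++ X) ≤ V X - + List.length p
V-takeAll (_ ∷ []) X (s≤s ())
V-takeAll (a ∷ b ∷ [])    X _ ((a≢b ∷ _) ∷ _) fresh = V-domino-≤ a≢b fresh
V-takeAll (a ∷ b ∷ c ∷ p) X _ u@(_ ∷ u′) fresh@(_ ∷ fresh′) = begin
  V (pathLines (a ∷ b ∷ c ∷ p) ++ X)         ≤⟨ V-takeFirst a b c p X u fresh ⟩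
  V (pathLines (b ∷ c ∷ p) ++ X) - + 1       ≤⟨ ℤ.+-monoˡ-≤ (- + 1) (V-takeAll (b ∷ c ∷ p) X (s≤s (s≤s z≤n)) u′ fresh′) ⟩
  (V X - + List.length (b ∷ c ∷ p)) - + 1    ≡⟨ identity (V X) (+ List.length (b ∷ c ∷ p)) ⟩
  V X - + List.length (a ∷ b ∷ c ∷ p)        ∎
  where
  open ℤ.≤-Reasoning
  identity : ∀ x l → (x - l) - + 1 ≡ x - (+ 1 + l)
  identity = solve-∀

-- Double-dealing: take all but the last four boxes and give those away as two dominoes.
V-doubleDeal : (p : List (Fin k)) (X : List (Line k)) → 4 ℕ.≤ List.length p → Unique p → Fresh X p →
               V (pathLines p ++ X) ≤ (+ 8 - + List.length p) - V X
V-doubleDeal (_ ∷ []) X (s≤s ())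
V-doubleDeal (_ ∷ _ ∷ []) X (s≤s (s≤s ()))
V-doubleDeal (_ ∷ _ ∷ _ ∷ []) X (s≤s (s≤s (s≤s ())))
V-doubleDeal (a ∷ b ∷ c ∷ d ∷ []) X _
  ((a≢b ∷ a≢c ∷ a≢d ∷ []) ∷ (b≢c ∷ b≢d ∷ []) ∷ (c≢d ∷ []) ∷ _) (da ∷ db ∷ dc ∷ dd ∷ []) = begin
  -- The middle line of the last four boxes claims nothing and leaves two dominoes. The result
  -- `4 - V X` is written `8 - 4 - V X` to match the formula for general length.
  V (line a b ∷ line b c ∷ line c d ∷ X)   ≤⟨ V-≤-claims (swap _ _ ↭-refl) (claims≡0 alive) ⟩
  - V (line a b ∷ line c d ∷ X)            ≤⟨ ℤ.neg-mono-≤ (V-domino-≥ a≢b fresh) ⟩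
  - (V (line c d ∷ X) - + 2)               ≤⟨ ℤ.neg-mono-≤ (ℤ.+-monoˡ-≤ (- + 2) (V-domino-≥ c≢d (dc ∷ dd ∷ []))) ⟩
  - ((V X - + 2) - + 2)                    ≡⟨ identity (V X) ⟩
  (+ 8 - + 4) - V X                        ∎
  where
  open ℤ.≤-Reasoning
  identity : ∀ x → - ((x - + 2) - + 2) ≡ (+ 8 - + 4) - x
  identity = solve-∀

  alive : ∀ x → Borders x (line b c) → Alive (line a b ∷ line c d ∷ X) x
  alive x e with borders-line⁻ b c e
  ... | inj₁ q = here (borders-line⁺ a b (inj₂ q))
  ... | inj₂ q = there (here (borders-line⁺ c d (inj₁ q)))

  fresh : Fresh (line c d ∷ X) (a ∷ b ∷ [])
  fresh = (λ { (here e) → Sum.[ a≢c , a≢d ] (borders-line⁻ c d e) ; (there q) → da q })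
        ∷ (λ { (here e) → Sum.[ b≢c , b≢d ] (borders-line⁻ c d e) ; (there q) → db q }) ∷ []
V-doubleDeal (a ∷ b ∷ c ∷ d ∷ e ∷ p) X _ u@(_ ∷ u′) fresh@(_ ∷ fresh′) = begin
  V (pathLines (a ∷ b ∷ c ∷ d ∷ e ∷ p) ++ X)
    ≤⟨ V-takeFirst a b c (d ∷ e ∷ p) X u fresh ⟩
  V (pathLines (b ∷ c ∷ d ∷ e ∷ p) ++ X) - + 1
    ≤⟨ ℤ.+-monoˡ-≤ (- + 1) (V-doubleDeal (b ∷ c ∷ d ∷ e ∷ p) X (s≤s (s≤s (s≤s (s≤s z≤n)))) u′ fresh′) ⟩
  ((+ 8 - + List.length (b ∷ c ∷ d ∷ e ∷ p)) - V X) - + 1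
    ≡⟨ identity (V X) (+ List.length (b ∷ c ∷ d ∷ e ∷ p)) ⟩
  (+ 8 - + List.length (a ∷ b ∷ c ∷ d ∷ e ∷ p)) - V X ∎
  where
  open ℤ.≤-Reasoning
  identity : ∀ x l → ((+ 8 - l) - x) - + 1 ≡ (+ 8 - (+ 1 + l)) - x
  identity = solve-∀

-- No play on an opened path beats the two plans

Quiet : List (Line k) → Set
Quiet L = ∀ {e L′} → L ↭ e ∷ L′ → ∀ x → Borders x e → Alive L′ x

module _ {k} (H : List (Line k)) (quiet : Quiet H) where

  Bound : List (Fin k) → Set
  Bound p = V H - + List.length p ≤ V (pathLines p ++ H)
          ⊎ (+ 8 - + List.length p) - V H ≤ V (pathLines p ++ H)

  -- Taking one end box shifts both alternatives and the value by the same 1, so whichever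
  -- alternative holds for the shorter path is inherited.
  bound-end : ∀ p q → List.length q ≡ suc (List.length p) →
              V (pathLines q ++ H) ≡ V (pathLines p ++ H) - + 1 → Bound p → Bound q
  bound-end p q len eq with List.length q | len
  ... | _ | refl rewrite eq = Sum.map
    (λ r → ≤-by-difference r (identity₁ (V H) (V (pathLines p ++ H)) (+ List.length p)))
    (λ r → ≤-by-difference r (identity₂ (V H) (V (pathLines p ++ H)) (+ List.length p)))
    where
    identity₁ : ∀ h v l → (v - + 1) - (h - (+ 1 + l)) ≡ v - (h - l)
    identity₁ = solve-∀

    identity₂ : ∀ h v l → (v - + 1) - ((+ 8 - (+ 1 + l)) - h) ≡ v - ((+ 8 - l) - h)
    identity₂ = solve-∀

  -- The cases are whether each side of the cut is a single box: the domino, the first box, the last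
  -- box, and an inner line. Only the inner line claims nothing and passes the turn.
  bound-cut : ∀ us a b vs → let q = (us ++ [ a ]) ++ b ∷ vs
                                L = pathLines (us ++ [ a ]) ++ pathLines (b ∷ vs) ++ H in
              Unique q → Fresh H q →
              (∀ p → suc (List.length p) ≡ List.length q → 2 ℕ.≤ List.length p →
                 Unique p → Fresh H p → Bound p) →
              V (pathLines q ++ H) ≡ moveValue (claims (line a b) L) (V L) → Bound q
  bound-cut [] a b [] ((a≢b ∷ _) ∷ _) fresh _ eq =
    inj₁ (ℤ.≤-reflexive (sym (trans eq (cong (λ j → moveValue j (V H)) (claims-domino a≢b fresh)))))
  bound-cut [] a b vs@(_ ∷ _) u@(_ ∷ u′) fresh@(_ ∷ fresh′) hyp eq =
    bound-end (b ∷ vs) _ refl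
      (trans eq (cong (λ j → moveValue j (V (pathLines (b ∷ vs) ++ H)))
                      (claims-first (s≤s (s≤s z≤n)) u fresh)))
      (hyp (b ∷ vs) refl (s≤s (s≤s z≤n)) u′ fresh′)
  bound-cut (c ∷ us) a b vs u fresh hyp eq
    with unique-++⁻ (c ∷ us ++ [ a ]) u | All.++⁻ (c ∷ us ++ [ a ]) fresh
  ... | uˡ , uʳ , disjoint | fˡ , fʳ = go vs eq uʳ disjoint fʳ hyp
    where
    xs : List (Fin k)
    xs = c ∷ us ++ [ a ]

    a∈ : a ∈ xs
    a∈ = there (∈-++⁺ʳ us (here refl))

    2≤ : 2 ℕ.≤ List.length xs
    2≤ = s≤s (subst (1 ℕ.≤_) (sym (List.length-++ us)) (ℕ.m≤n+m 1 (List.length us)))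

    go : ∀ vs → let q = xs ++ b ∷ vs
                    L = pathLines xs ++ pathLines (b ∷ vs) ++ H in
         V (pathLines q ++ H) ≡ moveValue (claims (line a b) L) (V L) →
         Unique (b ∷ vs) → (∀ {x} → x ∈ xs → ¬ x ∈ b ∷ vs) → Fresh H (b ∷ vs) →
         (∀ p → suc (List.length p) ≡ List.length q → 2 ℕ.≤ List.length p →
                 Unique p → Fresh H p → Bound p) →
         Bound q
    go [] eq _ disjoint (db ∷ _) hyp =
      bound-end xs (xs ++ [ b ]) len (trans eq (cong (λ j → moveValue j (V (pathLines xs ++ H))) one-claim))
        (hyp xs (sym len) 2≤ uˡ fˡ)
      where
      len : List.length (xs ++ [ b ]) ≡ suc (List.length xs)
      len = trans (List.length-++ xs) (ℕ.+-comm (List.length xs) 1)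

      one-claim : claims (line a b) (pathLines xs ++ H) ≡ 1
      one-claim = claims≡1 b
        ( borders-line⁺ a b (inj₂ refl)
        , Sum.[ (λ q → disjoint (alive-path⁻ xs q) (here refl)) , db ] ∘ Any.++⁻ (pathLines xs))
        λ x (e , d) → Sum.[ (λ { refl → ⊥-elim (d (Any.++⁺ˡ (alive-path⁺ xs 2≤ a∈))) }) , sym ]
                        (borders-line⁻ a b e)
    -- The opponent can take both pieces, so `- V L` is at least `lˡ + lʳ - V H`. Each piece has at
    -- least two boxes, so twice `lˡ + lʳ` is at least 8 and the double-dealing alternative follows.
    go vs@(_ ∷ _) eq uʳ disjoint fʳ _ = inj₂ (begin
      (+ 8 - + List.length (xs ++ b ∷ vs)) - V H
        ≡⟨ cong (λ l → (+ 8 - + l) - V H) (List.length-++ xs) ⟩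
      (+ 8 - (+ lˡ + + lʳ)) - V H
        ≤⟨ ≤-by-difference
             (ℤ.+-mono-≤ (ℤ.+-mono-≤ takeAllˡ takeAllʳ)
                         (ℤ.+-mono-≤ (+≤+ (ℕ.+-mono-≤ 2≤ (s≤s (s≤s (z≤n {List.length vs ℕ.∸ 1})))))
                                     (+≤+ (ℕ.+-mono-≤ 2≤ (s≤s (s≤s (z≤n {List.length vs ℕ.∸ 1})))))))
             (identity (V H) (+ lˡ) (+ lʳ) (V (pathLines (b ∷ vs) ++ H)) (V L)) ⟩
      - V L
        ≡⟨ trans eq (cong (λ j → moveValue j (V L)) (claims≡0 alive)) ⟨
      V (pathLines (xs ++ b ∷ vs) ++ H) ∎)
      where
      open ℤ.≤-Reasoning
      L : List (Line k)
      L = pathLines xs ++ pathLines (b ∷ vs) ++ H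

      lˡ lʳ : ℕ
      lˡ = List.length xs
      lʳ = List.length (b ∷ vs)

      takeAllˡ : V L ≤ V (pathLines (b ∷ vs) ++ H) - + lˡ
      takeAllˡ = V-takeAll xs _ 2≤ uˡ (fresh-++ (fresh-path disjoint) fˡ)

      takeAllʳ : V (pathLines (b ∷ vs) ++ H) ≤ V H - + lʳ
      takeAllʳ = V-takeAll (b ∷ vs) H (s≤s (s≤s z≤n)) uʳ fʳ

      identity : ∀ h l r v w → (- w) - ((+ 8 - (l + r)) - h) ≡
                 (((v - l) + (h - r)) + ((l + r) + (l + r))) - ((w + v) + (+ 4 + + 4))
      identity = solve-∀

      alive : ∀ x → Borders x (line a b) → Alive L x
      alive x e with borders-line⁻ a b e
      ... | inj₁ refl = Any.++⁺ˡ (alive-path⁺ xs 2≤ a∈)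
      ... | inj₂ refl = Any.++⁺ʳ (pathLines xs) (Any.++⁺ˡ (alive-path⁺ (b ∷ vs) (s≤s (s≤s z≤n)) (here refl)))

  -- Drawing a line of H, or an inner line of p, lets the opponent take all of p.
  bound : ∀ n p → List.length p ≡ n → 2 ℕ.≤ List.length p → Unique p → Fresh H p → Bound p
  bound n p@(_ ∷ []) len (s≤s ())
  bound (suc n) p@(p₀ ∷ p₁ ∷ p′) len 2≤n u fresh
    with V-attained (line p₀ p₁) (pathLines (p₁ ∷ p′) ++ H)
  ... | e , L , perm , attained with ∈-++⁻ (pathLines p) (∈-resp-↭ (↭-sym perm) (here refl))
  ...   | inj₂ e∈H = inj₁ (inH (∈⇒↭ e∈H))
    where
    inH : (∃ λ H′ → H ↭ e ∷ H′) → V H - + List.length p ≤ V (pathLines p ++ H)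
    inH (H′ , H↭) = begin
      -- The opponent takes the whole path, while `e` as a first move in `H` alone gives
      -- `V H ≤ - V H′`; the slack left is twice the length of the path.
      V H - + ∣p∣                    ≤⟨ ≤-by-difference
                          (ℤ.+-mono-≤ (ℤ.+-mono-≤ V-H (V-takeAll p H′ (s≤s (s≤s z≤n)) u (fresh-↭ H↭ fresh)))
                                           (+≤+ (z≤n {∣p∣ ℕ.+ ∣p∣})))
                          (identity (V H) (V H′) (V (pathLines p ++ H′)) (+ ∣p∣)) ⟩
      - V (pathLines p ++ H′)      ≡⟨ cong₂ moveValue none (V-↭ L↭) ⟨
      moveValue (claims e L) (V L) ≡⟨ attained ⟨
      V (pathLines p ++ H)         ∎
      where
      open ℤ.≤-Reasoning
      ∣p∣ : ℕ
      ∣p∣ = List.length p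

      V-H : V H ≤ - V H′
      V-H = V-≤-claims H↭ (claims≡0 (quiet H↭))

      L↭ : L ↭ pathLines p ++ H′
      L↭ = drop-∷ (↭-trans (↭-sym perm) (↭-trans (++⁺ˡ (pathLines p) H↭) (shift e (pathLines p) H′)))

      none : claims e L ≡ 0
      none = trans (claims-↭ e L↭) (claims≡0 (λ x b → Any.++⁺ʳ (pathLines p) (quiet H↭ x b)))

      identity : ∀ h h′ v l → (- v) - (h - l) ≡ ((- h′ + (h′ - l)) + (l + l)) - ((h + v) + 0ℤ)
      identity = solve-∀
  ...   | inj₁ e∈p with path-split p e∈p
  ...     | us , a , b , vs , p≡ , refl = subst Bound (sym p≡)
              (bound-cut us a b vs (subst Unique p≡ u) (subst (Fresh H) p≡ fresh)
                 (λ q len′ 2≤ → bound n q (ℕ.suc-injective (trans len′ (trans (cong List.length (sym p≡)) len))) 2≤)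
                 (trans (cong (λ p → V (pathLines p ++ H)) (sym p≡))
                        (trans attained (cong₂ moveValue (claims-↭ (line a b) L↭) (V-↭ L↭)))))
    where
    L↭ : L ↭ pathLines (us ++ [ a ]) ++ pathLines (b ∷ vs) ++ H
    L↭ = drop-∷ (↭-trans (↭-sym perm) (↭-trans
      (↭-reflexive (trans (cong (λ p → pathLines p ++ H) p≡)
                   (trans (cong (_++ H) (pathLines-split us a b vs))
                          (List.++-assoc (pathLines (us ++ [ a ])) _ H))))
      (shift (line a b) (pathLines (us ++ [ a ])) (pathLines (b ∷ vs) ++ H))))

-- Opening a loop

-- Repeating the first box at the end makes the closing line an ordinary line of a path.
loopLines : List (Fin k) → List (Line k)
loopLines []      = []
loopLines (a ∷ p) = pathLines (a ∷ p ++ [ a ])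

-- Unlike in `pathLines-split`, the box `a` belongs to both pieces, so no line is lost at the
-- junction.
pathLines-join : (ys : List (Fin k)) (a : Fin k) (r : List (Fin k)) →
                 pathLines (ys ++ a ∷ r) ≡ pathLines (ys ++ [ a ]) ++ pathLines (a ∷ r)
pathLines-join []           a r = refl
pathLines-join (u ∷ [])     a r = refl
pathLines-join (u ∷ w ∷ ys) a r = cong (line u w ∷_) (pathLines-join (w ∷ ys) a r)

Opening : List (Fin k) → Line k → Set
Opening c e = ∃ λ p → p ↭ c × loopLines c ↭ e ∷ pathLines p × (∀ {x} → Borders x e → x ∈ c)

-- Reading the cycle onwards from the far side of the cut gives a rotation of `c`, whose two pieces
-- are glued at the repeated first box. If the closing line is drawn, the order stays as it is,
-- which is the case of empty `vs`.
open-loop : (c : List (Fin k)) {e : Line k} → e ∈ loopLines c → Opening c e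
open-loop (a ∷ p) e∈ with path-split (a ∷ p ++ [ a ]) e∈
... | us , x , y , vs , eq , refl = cut (initLast vs) eq
  where
  start : ∀ us {ws} → a ∷ p ≡ (us ++ [ x ]) ++ ws → ∃ λ r → us ++ [ x ] ≡ a ∷ r
  start []       refl = [] , refl
  start (u ∷ us) refl = us ++ [ x ] , refl

  cut : ∀ {vs} → List.InitLast vs → a ∷ p ++ [ a ] ≡ (us ++ [ x ]) ++ y ∷ vs → Opening (a ∷ p) (line x y)
  cut List.[] eq with a∷p≡ , a≡y ← List.∷ʳ-injective (a ∷ p) (us ++ [ x ]) eq =
    a ∷ p , ↭-refl , lines , borders ∘ borders-line⁻ x y
    where
    lines : pathLines (a ∷ p ++ [ a ]) ↭ line x y ∷ pathLines (a ∷ p)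
    lines = ↭-trans (↭-reflexive (trans (cong pathLines eq) (pathLines-split us x y [])))
           (↭-trans (++-comm (pathLines (us ++ [ x ])) _) (prep _ (↭-reflexive (cong pathLines (sym a∷p≡)))))

    borders : ∀ {z} → z ≡ x ⊎ z ≡ y → z ∈ a ∷ p
    borders (inj₁ refl) = subst (x ∈_) (sym a∷p≡) (∈-++⁺ʳ us (here refl))
    borders (inj₂ refl) = here (sym a≡y)
  cut (ws ∷ʳ′ w) eq
    with a∷p≡ , a≡w ← List.∷ʳ-injective (a ∷ p) ((us ++ [ x ]) ++ y ∷ ws)
                        (trans eq (sym (List.++-assoc (us ++ [ x ]) (y ∷ ws) [ w ])))
    with r , us∷ʳx≡ ← start us a∷p≡ =
    (y ∷ ws) ++ us ++ [ x ]
    , ↭-trans (++-comm (y ∷ ws) (us ++ [ x ])) (↭-reflexive (sym a∷p≡))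
    , lines
    , borders ∘ borders-line⁻ x y
    where
    lines : pathLines (a ∷ p ++ [ a ]) ↭ line x y ∷ pathLines ((y ∷ ws) ++ us ++ [ x ])
    lines = begin
      pathLines (a ∷ p ++ [ a ])
        ≡⟨ trans (cong pathLines eq) (pathLines-split us x y (ws ++ [ w ])) ⟩
      pathLines (us ++ [ x ]) ++ line x y ∷ pathLines (y ∷ ws ++ [ w ])
        ↭⟨ shift (line x y) (pathLines (us ++ [ x ])) _ ⟩
      line x y ∷ pathLines (us ++ [ x ]) ++ pathLines (y ∷ ws ++ [ w ])
        ↭⟨ prep _ (++-comm (pathLines (us ++ [ x ])) _) ⟩
      line x y ∷ pathLines (y ∷ ws ++ [ w ]) ++ pathLines (us ++ [ x ])
        ≡⟨ cong (line x y ∷_) (cong₂ (λ v q → pathLines (y ∷ ws ++ [ v ]) ++ pathLines q) (sym a≡w) us∷ʳx≡) ⟩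
      line x y ∷ pathLines (y ∷ ws ++ [ a ]) ++ pathLines (a ∷ r)
        ≡⟨ cong (line x y ∷_) (pathLines-join (y ∷ ws) a r) ⟨
      line x y ∷ pathLines ((y ∷ ws) ++ a ∷ r)
        ≡⟨ cong (λ q → line x y ∷ pathLines ((y ∷ ws) ++ q)) us∷ʳx≡ ⟨
      line x y ∷ pathLines ((y ∷ ws) ++ us ++ [ x ]) ∎
      where open PermutationReasoning

    borders : ∀ {z} → z ≡ x ⊎ z ≡ y → z ∈ a ∷ p
    borders (inj₁ refl) = subst (x ∈_) (sym a∷p≡) (∈-++⁺ˡ (∈-++⁺ʳ us (here refl)))
    borders (inj₂ refl) = subst (y ∈_) (sym a∷p≡) (∈-++⁺ʳ (us ++ [ x ]) (here refl))

alive-loops : (cs : List (List (Fin k))) {x : Fin k} → Alive (concatMap loopLines cs) x → x ∈ concat cs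
alive-loops ((a ∷ p) ∷ cs) alive with Any.++⁻ (loopLines (a ∷ p)) alive
... | inj₂ q = ∈-++⁺ʳ (a ∷ p) (alive-loops cs q)
... | inj₁ q with ∈-++⁻ (a ∷ p) (alive-path⁻ (a ∷ p ++ [ a ]) q)
...   | inj₁ x∈         = ∈-++⁺ˡ x∈
...   | inj₂ (here refl) = here refl
alive-loops ([] ∷ cs) alive = alive-loops cs alive

record Valid (cs : List (List (Fin k))) : Set where
  field
    unique : Unique (concat cs)
    long   : All (λ c → 4 ℕ.≤ List.length c) cs

unique-↭ : {A : Set} {xs ys : List A} → xs ↭ ys → Unique xs → Unique ys
unique-↭ p = Permutation.Unique-resp-↭ (setoid _) (↭⇒↭ₛ p)

concatMap-shift : {A B : Set} (f : A → List B) (xs : List A) (y : A) (zs : List A) →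
                  concatMap f (xs ++ y ∷ zs) ↭ f y ++ concatMap f (xs ++ zs)
concatMap-shift f xs y zs = begin
  concatMap f (xs ++ y ∷ zs)                   ≡⟨ List.concatMap-++ f xs (y ∷ zs) ⟩
  concatMap f xs ++ f y ++ concatMap f zs      ↭⟨ ++⁺ˡ (concatMap f xs) (++-comm (f y) _) ⟩
  concatMap f xs ++ concatMap f zs ++ f y      ≡⟨ List.++-assoc (concatMap f xs) _ _ ⟨
  (concatMap f xs ++ concatMap f zs) ++ f y    ≡⟨ cong (_++ f y) (List.concatMap-++ f xs zs) ⟨
  concatMap f (xs ++ zs) ++ f y                ↭⟨ ++-comm _ (f y) ⟩
  f y ++ concatMap f (xs ++ zs)                ∎
  where open PermutationReasoning

module _ {k} {xs ys : List (List (Fin k))} {c : List (Fin k)} (valid : Valid (xs ++ c ∷ ys)) where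

  open Valid valid

  private
    unique′ : Unique (c ++ concat (xs ++ ys))
    -- `concat` is treated as `concatMap id`, so that the same shift serves for the boxes and for
    -- the lines.
    unique′ = unique-↭ (subst₂ _↭_ (cong concat (List.map-id (xs ++ c ∷ ys)))
                         (cong (λ z → c ++ concat z) (List.map-id (xs ++ ys)))
                         (concatMap-shift id xs c ys)) unique

  valid-remove : Valid (xs ++ ys)
  valid-remove = record
    { unique = proj₁ (proj₂ (unique-++⁻ c unique′))
    ; long   = All.++⁺ (All.++⁻ˡ xs long) (All.tail (All.++⁻ʳ xs long))
    }

  loop-unique : Unique c
  loop-unique = proj₁ (unique-++⁻ c unique′)

  loop-long : 4 ℕ.≤ List.length c
  loop-long = All.head (All.++⁻ʳ xs long)

  loop-fresh : Fresh (concatMap loopLines (xs ++ ys)) c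
  loop-fresh = All.tabulate λ x∈c alive →
    proj₂ (proj₂ (unique-++⁻ c unique′)) x∈c (alive-loops (xs ++ ys) alive)

  open-loops : ∀ {e L} → e ∈ loopLines c → concatMap loopLines (xs ++ c ∷ ys) ↭ e ∷ L →
               ∃ λ p → p ↭ c × L ↭ pathLines p ++ concatMap loopLines (xs ++ ys)
                     × (∀ {x} → Borders x e → x ∈ c)
  open-loops {e} {L} e∈c L↭ with open-loop c e∈c
  ... | p , p↭c , lines , borders = p , p↭c , drop-∷ rest , borders
    where
    rest : e ∷ L ↭ e ∷ (pathLines p ++ concatMap loopLines (xs ++ ys))
    rest = ↭-trans (↭-sym L↭) (↭-trans (concatMap-shift loopLines xs c ys) (++⁺ʳ _ lines))

  alive-opened : ∀ {p x} → p ↭ c → x ∈ c → Alive (pathLines p ++ concatMap loopLines (xs ++ ys)) x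
  alive-opened {p} p↭c x∈c = Any.++⁺ˡ (alive-path⁺ p
    (ℕ.≤-trans (s≤s (s≤s z≤n)) (ℕ.≤-trans loop-long (ℕ.≤-reflexive (sym (↭-length p↭c)))))
    (∈-resp-↭ (↭-sym p↭c) x∈c))

∈-concatMap⁻ : {A B : Set} (f : A → List B) {y : B} (xs : List A) → y ∈ concatMap f xs →
               ∃ λ us → ∃ λ x → ∃ λ vs → xs ≡ us ++ x ∷ vs × y ∈ f x
∈-concatMap⁻ f (x ∷ xs) y∈ with ∈-++⁻ (f x) y∈
... | inj₁ y∈x = [] , x , xs , refl , y∈x
... | inj₂ y∈xs with ∈-concatMap⁻ f xs y∈xs
...   | us , z , vs , refl , y∈z = x ∷ us , z , vs , refl , y∈z

-- Every line opens its own loop, and each box of that loop still lies on the remaining path, which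
-- is long enough for all its boxes to have a line.
loops-quiet : {cs : List (List (Fin k))} → Valid cs → Quiet (concatMap loopLines cs)
loops-quiet {cs = cs} valid L↭ x b
  with us , c , vs , refl , e∈c ← ∈-concatMap⁻ loopLines cs (∈-resp-↭ (↭-sym L↭) (here refl))
  with p , p↭c , L′↭ , borders ← open-loops valid e∈c L↭ =
  Any-resp-↭ (↭-sym L′↭) (alive-opened valid p↭c (borders b))

-- The recursion for disjoint cycles

-- The controller's net gain from an opened ℓ-loop beside a position of value x: take all
-- of it, or double-deal.
control : ℕ → ℤ → ℤ
control ℓ x = (+ ℓ - x) ⊔ ((+ ℓ - + 8) + x)

module _ {k} {p : List (Fin k)} {H : List (Line k)} (4≤ : 4 ℕ.≤ List.length p)
         (unique : Unique p) (fresh : Fresh H p) where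

  private
    2≤ : 2 ℕ.≤ List.length p
    2≤ = ℕ.≤-trans (s≤s (s≤s z≤n)) 4≤

    identity₁ : ∀ l h v → (- v) - (l - h) ≡ (h - l) - v
    identity₁ = solve-∀

    identity₂ : ∀ l h v → (- v) - ((l - + 8) + h) ≡ ((+ 8 - l) - h) - v
    identity₂ = solve-∀

    identity₁′ : ∀ l h v → (l - h) - (- v) ≡ v - (h - l)
    identity₁′ = solve-∀

    identity₂′ : ∀ l h v → ((l - + 8) + h) - (- v) ≡ v - ((+ 8 - l) - h)
    identity₂′ = solve-∀

  control-≤ : control (List.length p) (V H) ≤ - V (pathLines p ++ H)
  control-≤ = ℤ.⊔-lub
    (≤-by-difference (V-takeAll p H 2≤ unique fresh) (identity₁ (+ List.length p) (V H) _))
    (≤-by-difference (V-doubleDeal p H 4≤ unique fresh) (identity₂ (+ List.length p) (V H) _))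

  ≤-control : Quiet H → - V (pathLines p ++ H) ≤ control (List.length p) (V H)
  ≤-control quiet with bound H quiet (List.length p) p refl 2≤ unique fresh
  ... | inj₁ q = ℤ.≤-trans (≤-by-difference q (identity₁′ (+ List.length p) (V H) _)) (ℤ.i≤i⊔j _ _)
  ... | inj₂ q = ℤ.≤-trans (≤-by-difference q (identity₂′ (+ List.length p) (V H) _))
                           (ℤ.i≤j⊔i (+ List.length p - V H) _)

some-line : (c : List (Fin k)) → 4 ℕ.≤ List.length c → ∃ λ e → e ∈ loopLines c
some-line (a ∷ [])    (s≤s ())
some-line (a ∷ b ∷ p) _ = line a b , here refl

module _ {k} {xs ys : List (List (Fin k))} {c : List (Fin k)} (valid : Valid (xs ++ c ∷ ys)) where

  private
    H : List (Line k)
    H = concatMap loopLines (xs ++ ys)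

  V-opened : ∀ {p} → p ↭ c → - V (pathLines p ++ H) ≡ control (List.length c) (V H)
  V-opened {p} p↭c rewrite sym (↭-length p↭c) = ℤ.≤-antisym
    (≤-control 4≤ u f (loops-quiet (valid-remove {xs = xs} valid))) (control-≤ 4≤ u f)
    where
    4≤ : 4 ℕ.≤ List.length p
    4≤ = subst (4 ℕ.≤_) (sym (↭-length p↭c)) (loop-long {xs = xs} valid)

    u : Unique p
    u = unique-↭ (↭-sym p↭c) (loop-unique {xs = xs} valid)

    f : Fresh H p
    f = All-resp-↭ (↭-sym p↭c) (loop-fresh {xs = xs} valid)

  opening-value : ∀ {e L} → e ∈ loopLines c → concatMap loopLines (xs ++ c ∷ ys) ↭ e ∷ L →
                  moveValue (claims e L) (V L) ≡ control (List.length c) (V H)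
  opening-value {e} {L} e∈c L↭ with p , p↭c , L↭′ , borders ← open-loops {xs = xs} valid e∈c L↭ =
    trans (cong₂ moveValue
             (trans (claims-↭ e L↭′) (claims≡0 (λ x b → alive-opened {xs = xs} valid p↭c (borders b))))
             (V-↭ L↭′))
          (V-opened p↭c)

  V-loops-≤ : V (concatMap loopLines (xs ++ c ∷ ys)) ≤ control (List.length c) (V H)
  V-loops-≤ with e , e∈c ← some-line c (loop-long {xs = xs} valid)
    with L , L↭ ← ∈⇒↭ (∈-resp-↭ (↭-sym (concatMap-shift loopLines xs c ys)) (∈-++⁺ˡ e∈c)) =
    subst (V (concatMap loopLines (xs ++ c ∷ ys)) ≤_) (opening-value e∈c L↭) (V-≤ L↭)

loopLines-≢[] : {cs : List (List (Fin k))} → Valid cs → cs ≢ [] → concatMap loopLines cs ≢ []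
loopLines-≢[] {cs = []}                _     ne _ = ne refl
loopLines-≢[] {cs = [] ∷ _}            valid _  _ = case All.head (Valid.long valid) of λ ()
loopLines-≢[] {cs = (_ ∷ []) ∷ _}      valid _  _ = case All.head (Valid.long valid) of λ { (s≤s ()) }
loopLines-≢[] {cs = (_ ∷ _ ∷ _) ∷ _}   _     _  ()

V-loops-attained : {cs : List (List (Fin k))} → Valid cs → cs ≢ [] →
  ∃ λ xs → ∃ λ c → ∃ λ ys → cs ≡ xs ++ c ∷ ys
    × V (concatMap loopLines cs) ≡ control (List.length c) (V (concatMap loopLines (xs ++ ys)))
V-loops-attained {cs = cs} valid cs≢[]
  with e , L , L↭ , attained ← V-attained-≢[] (loopLines-≢[] valid cs≢[])
  with xs , c , ys , refl , e∈c ← ∈-concatMap⁻ loopLines cs (∈-resp-↭ (↭-sym L↭) (here refl)) =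
  xs , c , ys , refl , trans attained (opening-value {xs = xs} valid e∈c L↭)

-- Dependence on the loop lengths alone

map-≡-++ : {A B C : Set} {f : A → C} {g : B → C} (as : List A) (xs : List B) {y : B} {zs : List B} →
           List.map f as ≡ List.map g (xs ++ y ∷ zs) →
           ∃ λ xs′ → ∃ λ y′ → ∃ λ zs′ → as ≡ xs′ ++ y′ ∷ zs′ × f y′ ≡ g y
             × List.map f (xs′ ++ zs′) ≡ List.map g (xs ++ zs)
map-≡-++ (a ∷ as) []       eq = [] , a , as , refl , List.∷-injectiveˡ eq , List.∷-injectiveʳ eq
map-≡-++ (a ∷ as) (x ∷ xs) eq with map-≡-++ as xs (List.∷-injectiveʳ eq)
... | xs′ , y′ , zs′ , refl , y≡ , zs≡ =
      a ∷ xs′ , y′ , zs′ , refl , y≡ , cong₂ _∷_ (List.∷-injectiveˡ eq) zs≡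

length-remove : {A : Set} (xs : List A) {y : A} {ys : List A} {n : ℕ} →
                List.length (xs ++ y ∷ ys) ≡ suc n → List.length (xs ++ ys) ≡ n
length-remove xs {y} {ys} eq = ℕ.suc-injective (trans (sym (↭-length (shift y xs ys))) eq)

-- After a loop is removed, the rest still lives on the box names of the larger game; this compares
-- it with a game that has its own names. Both values satisfy the same recursion, in which only
-- lengths occur.
V-lengths : ∀ {k k′} (cs : List (List (Fin k))) (ds : List (List (Fin k′))) → Valid cs → Valid ds →
            List.map List.length cs ≡ List.map List.length ds →
            V (concatMap loopLines cs) ≡ V (concatMap loopLines ds)
V-lengths {k} {k′} cs ds = go (List.length cs) cs ds refl
  where
  Equal : ∀ {k k′} → List (List (Fin k)) → List (List (Fin k′)) → Set
  Equal cs ds = V (concatMap loopLines cs) ≡ V (concatMap loopLines ds)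

  -- The loop that attains the minimum for `ds` is opened at the same index in `cs`; the induction
  -- hypothesis is an argument so that both inequalities can use it.
  half : ∀ {k k′ n} {cs : List (List (Fin k))} {ds : List (List (Fin k′))} →
         List.length ds ≡ suc n → Valid cs → Valid ds →
         List.map List.length cs ≡ List.map List.length ds →
         (∀ cs ds → List.length ds ≡ n → Valid cs → Valid ds →
            List.map List.length cs ≡ List.map List.length ds → Equal cs ds) →
         V (concatMap loopLines cs) ≤ V (concatMap loopLines ds)
  half {cs = cs} {ds} len valid-cs valid-ds eq hyp
    with xs , d , ys , refl , attained ← V-loops-attained valid-ds (λ { refl → case len of λ () })
    with xs′ , c , ys′ , refl , c≡d , eq′ ← map-≡-++ cs xs eq =
    ℤ.≤-trans (V-loops-≤ {xs = xs′} valid-cs) (ℤ.≤-reflexive (trans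
      (cong₂ control c≡d (hyp (xs′ ++ ys′) (xs ++ ys) (length-remove xs len)
        (valid-remove {xs = xs′} valid-cs) (valid-remove {xs = xs} valid-ds) eq′))
      (sym attained)))

  go : ∀ {k k′} n (cs : List (List (Fin k))) (ds : List (List (Fin k′))) → List.length cs ≡ n →
       Valid cs → Valid ds → List.map List.length cs ≡ List.map List.length ds → Equal cs ds
  go zero [] [] len _ _ eq = trans (sym (value≡V [])) (value≡V [])
  go (suc n) cs ds len valid-cs valid-ds eq = ℤ.≤-antisym
    (half len′ valid-cs valid-ds eq (λ cs ds l vc vd eq → go n cs ds (trans (lengths cs ds eq) l) vc vd eq))
    (half len valid-ds valid-cs (sym eq) (λ ds cs l vd vc eq → sym (go n cs ds l vc vd (sym eq))))
    where
    lengths : ∀ {k k′} (cs : List (List (Fin k))) (ds : List (List (Fin k′))) →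
              List.map List.length cs ≡ List.map List.length ds → List.length cs ≡ List.length ds
    lengths cs ds eq = trans (sym (List.length-map List.length cs))
                             (trans (cong List.length eq) (List.length-map List.length ds))

    len′ : List.length ds ≡ suc n
    len′ = trans (sym (lengths cs ds eq)) len

-- The given games as disjoint cycles

toList-tabulate : {A : Set} (f : Fin n → A) → toList (Vec.tabulate f) ≡ List.tabulate f
toList-tabulate {zero}  f = refl
toList-tabulate {suc n} f = cong (f zero ∷_) (toList-tabulate (f ∘ suc))

-- Meant for `f` the identity and `g` the cyclic successor: every step but the last stays in the
-- list, and the last one reaches the repeated first box `z`.
pathLines-tabulate : (f g : Fin (suc n) → Fin k) (z : Fin k) →
                     (∀ i → g (inject₁ i) ≡ f (suc i)) → g (fromℕ n) ≡ z →
                     pathLines (List.tabulate f ++ [ z ]) ≡ List.tabulate (λ i → line (f i) (g i))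
pathLines-tabulate {zero}  f g z step end = cong (λ x → line (f zero) x ∷ []) (sym end)
pathLines-tabulate {suc n} f g z step end =
  cong₂ _∷_ (cong (line (f zero)) (sym (step zero)))
            (pathLines-tabulate (f ∘ suc) (g ∘ suc) z (step ∘ suc) end)

next-inject₁ : (i : Fin n) → next (inject₁ i) ≡ suc i
next-inject₁ {n} i = Fin.toℕ-injective (begin
  toℕ (next (inject₁ i))               ≡⟨ Fin.toℕ-fromℕ< _ ⟩
  suc (toℕ (inject₁ i)) ℕ.% suc n      ≡⟨ cong (λ j → suc j ℕ.% suc n) (Fin.toℕ-inject₁ i) ⟩
  suc (toℕ i) ℕ.% suc n                ≡⟨ m<n⇒m%n≡m (s≤s (Fin.toℕ<n i)) ⟩
  suc (toℕ i)                          ∎)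
  where open ≡-Reasoning

next-fromℕ : ∀ n → next (fromℕ n) ≡ zero
next-fromℕ n = Fin.toℕ-injective (begin
  toℕ (next (fromℕ n))            ≡⟨ Fin.toℕ-fromℕ< _ ⟩
  suc (toℕ (fromℕ n)) ℕ.% suc n   ≡⟨ cong (λ j → suc j ℕ.% suc n) (Fin.toℕ-fromℕ n) ⟩
  suc n ℕ.% suc n                 ≡⟨ n%n≡0 (suc n) ⟩
  0                               ∎)
  where open ≡-Reasoning

loopGame-lines : (ℓ : Loop) → toList (Game.lines (loopGame ℓ)) ≡ loopLines (List.allFin (length ℓ))
loopGame-lines (mkLoop (suc n) 4≤n) = begin
  toList (Game.lines (loopGame (mkLoop (suc n) 4≤n)))
    ≡⟨ toList-tabulate edge ⟩
  List.tabulate edge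
    ≡⟨ List.tabulate-cong (λ i → line-two (next≢ i)) ⟩
  List.tabulate (λ i → line i (next i))
    ≡⟨ pathLines-tabulate id next zero next-inject₁ (next-fromℕ n) ⟨
  loopLines (List.allFin (suc n)) ∎
  where
  open ≡-Reasoning

  next≢ : (i : Fin (suc n)) → i ≢ next i
  next≢ = next-≢ (ℕ.≤-trans (s≤s (s≤s z≤n)) 4≤n)

  edge : Fin (suc n) → Line (suc n)
  edge i = two i (next i) (next≢ i)

module _ (f : Fin k → Fin l) (rename : Line k → Line l)
         (rename-line : ∀ a b → rename (line a b) ≡ line (f a) (f b)) where

  rename-path : ∀ p → List.map rename (pathLines p) ≡ pathLines (List.map f p)
  rename-path []          = refl
  rename-path (a ∷ [])    = refl
  rename-path (a ∷ b ∷ p) = cong₂ _∷_ (rename-line a b) (rename-path (b ∷ p))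

  rename-loop : ∀ c → List.map rename (loopLines c) ≡ loopLines (List.map f c)
  rename-loop []      = refl
  rename-loop (a ∷ p) = trans (rename-path (a ∷ p ++ [ a ])) (cong (pathLines ∘ (f a ∷_)) (List.map-++ f p [ a ]))

  rename-loops : ∀ cs → List.map rename (concatMap loopLines cs) ≡ concatMap loopLines (List.map (List.map f) cs)
  rename-loops []       = refl
  rename-loops (c ∷ cs) = trans (List.map-++ rename (loopLines c) _) (cong₂ _++_ (rename-loop c) (rename-loops cs))

renameˡ-line : ∀ l (a b : Fin k) → renameˡ l (line a b) ≡ line (a ↑ˡ l) (b ↑ˡ l)
renameˡ-line l a b with a Fin.≟ b
... | no a≢b = line-two (a≢b ∘ Fin.↑ˡ-injective l a b)
... | yes refl with (a ↑ˡ l) Fin.≟ (a ↑ˡ l)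
...   | yes _ = refl
...   | no ≢  = ⊥-elim (≢ refl)

renameʳ-line : ∀ k (a b : Fin l) → renameʳ k (line a b) ≡ line (k ↑ʳ a) (k ↑ʳ b)
renameʳ-line k a b with a Fin.≟ b
... | no a≢b = line-two (a≢b ∘ Fin.↑ʳ-injective k a b)
... | yes refl with (k ↑ʳ a) Fin.≟ (k ↑ʳ a)
...   | yes _ = refl
...   | no ≢  = ⊥-elim (≢ refl)

↑ˡ≢↑ʳ : (a : Fin k) (b : Fin l) → a ↑ˡ l ≢ k ↑ʳ b
↑ˡ≢↑ʳ {k} {l} a b e
  with () ← trans (sym (Fin.splitAt-↑ˡ k a l)) (trans (cong (splitAt k) e) (Fin.splitAt-↑ʳ k l b))

-- The bridge from games built by `_⊕_` to disjoint cycles of box names, on which the recursion has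
-- been established.
record Layout (ℓs : List Loop) : Set where
  field
    cycles  : List (List (Fin (Game.boxes (loops ℓs))))
    valid   : Valid cycles
    lengths : List.map List.length cycles ≡ List.map length ℓs
    lines   : toList (Game.lines (loops ℓs)) ≡ concatMap loopLines cycles

  v≡V : v (loops ℓs) ≡ V (concatMap loopLines cycles)
  v≡V = trans (value≡V (Game.lines (loops ℓs))) (cong V lines)

layout : ∀ ℓs → Layout ℓs
layout []       = record { cycles = [] ; valid = record { unique = [] ; long = [] } ; lengths = refl ; lines = refl }
layout (ℓ ∷ ℓs) = record
  { cycles  = List.map (_↑ˡ r) (List.allFin m) ∷ List.map (List.map (m ↑ʳ_)) cycles
  ; valid   = record
    { unique = subst (λ bs → Unique (List.map (_↑ˡ r) (List.allFin m) ++ bs)) (sym (List.concat-map cycles))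
        (Unique.++⁺ (Unique.map⁺ (Fin.↑ˡ-injective r _ _) (Unique.allFin⁺ m))
                    (Unique.map⁺ (Fin.↑ʳ-injective m _ _) (Valid.unique valid))
                    disjoint)
    ; long = subst (4 ℕ.≤_) (sym lengthˡ) (4≤length ℓ)
           ∷ All.map⁺ (All.map (λ {c} → subst (4 ℕ.≤_) (sym (List.length-map (m ↑ʳ_) c))) (Valid.long valid))
    }
  ; lengths = cong₂ _∷_ lengthˡ (trans (sym (List.map-∘ cycles))
                (trans (List.map-cong (List.length-map (m ↑ʳ_)) cycles) lengths))
  ; lines   = begin
      toList (Game.lines (loops (ℓ ∷ ℓs)))
        ≡⟨ Vec.toList-++ (Vec.map (renameˡ r) (Game.lines (loopGame ℓ))) _ ⟩
      toList (Vec.map (renameˡ r) (Game.lines (loopGame ℓ)))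
        ++ toList (Vec.map (renameʳ m) (Game.lines (loops ℓs)))
        ≡⟨ cong₂ _++_ (Vec.toList-map (renameˡ r) (Game.lines (loopGame ℓ))) (Vec.toList-map (renameʳ m) (Game.lines (loops ℓs))) ⟩
      List.map (renameˡ r) (toList (Game.lines (loopGame ℓ)))
        ++ List.map (renameʳ m) (toList (Game.lines (loops ℓs)))
        ≡⟨ cong₂ (λ xs ys → List.map (renameˡ r) xs ++ List.map (renameʳ m) ys) (loopGame-lines ℓ) lines ⟩
      List.map (renameˡ r) (loopLines (List.allFin m)) ++ List.map (renameʳ m) (concatMap loopLines cycles)
        ≡⟨ cong₂ _++_ (rename-loop (_↑ˡ r) (renameˡ r) (renameˡ-line r) (List.allFin m))
                      (rename-loops (m ↑ʳ_) (renameʳ m) (renameʳ-line m) cycles) ⟩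
      loopLines (List.map (_↑ˡ r) (List.allFin m)) ++ concatMap loopLines (List.map (List.map (m ↑ʳ_)) cycles) ∎
  }
  where
  open ≡-Reasoning
  open Layout (layout ℓs)

  m r : ℕ
  m = length ℓ
  r = Game.boxes (loops ℓs)

  lengthˡ : List.length (List.map (_↑ˡ r) (List.allFin m)) ≡ m
  lengthˡ = trans (List.length-map (_↑ˡ r) (List.allFin m)) (List.length-tabulate id)

  disjoint : ∀ {x} → ¬ (x ∈ List.map (_↑ˡ r) (List.allFin m) × x ∈ List.map (m ↑ʳ_) (concat cycles))
  disjoint (x∈ˡ , x∈ʳ)
    with a , _ , refl ← ∈-map⁻ (_↑ˡ r) x∈ˡ
    with b , _ , e ← ∈-map⁻ (m ↑ʳ_) x∈ʳ = ↑ˡ≢↑ʳ a b e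

v-removed : (xs ys : List Loop) {us vs : List (List (Fin k))} → Valid (us ++ vs) →
            List.map List.length (us ++ vs) ≡ List.map length (xs ++ ys) →
            V (concatMap loopLines (us ++ vs)) ≡ v (loops (xs ++ ys))
v-removed xs ys {us} {vs} valid-us eq = trans
  (V-lengths (us ++ vs) cycles valid-us valid (trans eq (sym lengths)))
  (sym v≡V)
  where open Layout (layout (xs ++ ys))

-- The recursion for the value of a union of loops

v-≤ : (xs : List Loop) (ℓ : Loop) (ys : List Loop) →
      v (loops (xs ++ ℓ ∷ ys)) ≤ control (length ℓ) (v (loops (xs ++ ys)))
v-≤ xs ℓ ys = go cycles valid lengths v≡V
  where
  open Layout (layout (xs ++ ℓ ∷ ys))
  go : ∀ cs → Valid cs → List.map List.length cs ≡ List.map length (xs ++ ℓ ∷ ys) →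
       v (loops (xs ++ ℓ ∷ ys)) ≡ V (concatMap loopLines cs) →
       v (loops (xs ++ ℓ ∷ ys)) ≤ control (length ℓ) (v (loops (xs ++ ys)))
  go cs valid lengths v≡ with us , c , vs , refl , c≡ , rest ← map-≡-++ cs xs lengths =
    ℤ.≤-trans (ℤ.≤-reflexive v≡) (ℤ.≤-trans (V-loops-≤ {xs = us} valid)
      (ℤ.≤-reflexive (cong₂ control c≡ (v-removed xs ys {us} (valid-remove {xs = us} valid) rest))))

map-≢[] : {A B C : Set} {f : A → C} {g : B → C} {as : List A} {bs : List B} →
          List.map f as ≡ List.map g bs → bs ≢ [] → as ≢ []
map-≢[] {bs = []}    _  bs≢[] refl = bs≢[] refl
map-≢[] {bs = _ ∷ _} () _     refl

v-attained : (ℓs : List Loop) → ℓs ≢ [] →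
             ∃ λ xs → ∃ λ ℓ → ∃ λ ys → ℓs ≡ xs ++ ℓ ∷ ys
               × v (loops ℓs) ≡ control (length ℓ) (v (loops (xs ++ ys)))
v-attained ℓs ℓs≢[] = go cycles valid lengths v≡V
  where
  open Layout (layout ℓs)
  go : ∀ cs → Valid cs → List.map List.length cs ≡ List.map length ℓs →
       v (loops ℓs) ≡ V (concatMap loopLines cs) →
       ∃ λ xs → ∃ λ ℓ → ∃ λ ys → ℓs ≡ xs ++ ℓ ∷ ys
         × v (loops ℓs) ≡ control (length ℓ) (v (loops (xs ++ ys)))
  go cs valid lengths v≡
    with us , c , vs , refl , attained ← V-loops-attained valid (map-≢[] lengths ℓs≢[])
    with xs , ℓ , ys , ℓs≡ , ℓ≡ , rest ← map-≡-++ ℓs us (sym lengths) =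
    xs , ℓ , ys , ℓs≡ , trans v≡ (trans attained
      (cong₂ control (sym ℓ≡) (v-removed xs ys {us} (valid-remove {xs = us} valid) (sym rest))))

-- Controlled value and parity

-- The controller's net gain if every loop is double-dealt. A non-empty `cv` is 8 more, since the
-- last loop is taken whole.
excess : List Loop → ℤ
excess = List.foldr _+_ 0ℤ ∘ List.map (λ ℓ → + length ℓ - + 8)

Even : List Loop → Set
Even = All (λ ℓ → 2 ℕ.∣ length ℓ)

cv-nonempty : ∀ {ℓs} → ℓs ≢ [] → cv ℓs ≡ + 8 + excess ℓs
cv-nonempty {[]}    ne = contradiction refl ne
cv-nonempty {_ ∷ _} _  = refl

excess-remove : ∀ xs ℓ ys → excess (xs ++ ℓ ∷ ys) ≡ excess (xs ++ ys) + (+ length ℓ - + 8)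
excess-remove []       ℓ ys = ℤ.+-comm (+ length ℓ - + 8) (excess ys)
excess-remove (x ∷ xs) ℓ ys = trans (cong (_+_ (+ length x - + 8)) (excess-remove xs ℓ ys))
                                    (sym (ℤ.+-assoc (+ length x - + 8) (excess (xs ++ ys)) _))

insert-≢[] : {A : Set} (xs : List A) {y : A} {ys : List A} → xs ++ y ∷ ys ≢ []
insert-≢[] []      ()
insert-≢[] (_ ∷ _) ()

[]-or-≢[] : {A : Set} (xs : List A) → xs ≡ [] ⊎ xs ≢ []
[]-or-≢[] []      = inj₁ refl
[]-or-≢[] (_ ∷ _) = inj₂ λ ()

-- Something must remain: the extra 8 in `cv` disappears together with the last loop, the case
-- treated by `cv-single`.
cv-remove : ∀ xs ℓ ys → xs ++ ys ≢ [] → cv (xs ++ ℓ ∷ ys) ≡ cv (xs ++ ys) + (+ length ℓ - + 8)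
cv-remove xs ℓ ys ne = begin
  cv (xs ++ ℓ ∷ ys)                                   ≡⟨ cv-nonempty (insert-≢[] xs) ⟩
  + 8 + excess (xs ++ ℓ ∷ ys)                         ≡⟨ cong (_+_ (+ 8)) (excess-remove xs ℓ ys) ⟩
  + 8 + (excess (xs ++ ys) + (+ length ℓ - + 8))      ≡⟨ ℤ.+-assoc (+ 8) (excess (xs ++ ys)) _ ⟨
  + 8 + excess (xs ++ ys) + (+ length ℓ - + 8)        ≡⟨ cong (_+ (+ length ℓ - + 8)) (cv-nonempty ne) ⟨
  cv (xs ++ ys) + (+ length ℓ - + 8)                  ∎
  where open ≡-Reasoning

cv-single : ∀ xs ℓ ys → xs ++ ys ≡ [] → cv (xs ++ ℓ ∷ ys) ≡ + length ℓ
cv-single [] ℓ [] _ = identity (+ length ℓ)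
  where
  identity : ∀ l → + 8 + ((l - + 8) + 0ℤ) ≡ l
  identity = solve-∀

∣-resp-≡ : ∀ {m a b} → b ≡ a → m ∣ a → m ∣ b
∣-resp-≡ e = subst (_ ∣_) (sym e)

cv-even : ∀ {ℓs} → Even ℓs → + 2 ∣ cv ℓs
cv-even []              = divides (+ 0) refl
cv-even even@(_ ∷ _)    = ∣m∣n⇒∣m+n (divides (+ 4) refl) (excess-even even)
  where
  excess-even : ∀ {ℓs} → Even ℓs → + 2 ∣ excess ℓs
  excess-even []       = divides (+ 0) refl
  excess-even {ℓ ∷ _} (e ∷ es) = ∣m∣n⇒∣m+n (∣m∣n⇒∣m-n (∣ᵤ⇒∣ {i = + length ℓ} e) (divides (+ 4) refl)) (excess-even es)

even-split : ∀ {z} → + 2 ∣ z → z ≤ 0ℤ ⊎ + 2 ≤ z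
even-split { -[1+ _ ]}         _ = inj₁ -≤+
even-split {+ 0}               _ = inj₁ ℤ.≤-refl
even-split {+ 1}               d = contradiction d (from-no (+ 2 ∣? + 1))
even-split {+ (suc (suc _))}   _ = inj₂ (+≤+ (s≤s (s≤s z≤n)))

even-range : ∀ {z} → 0ℤ ≤ z → z ≤ + 4 → + 2 ∣ z → z ≡ + 0 ⊎ z ≡ + 2 ⊎ z ≡ + 4
even-range {+ 0} _ _ _ = inj₁ refl
even-range {+ 1} _ _ d = contradiction d (from-no (+ 2 ∣? + 1))
even-range {+ 2} _ _ _ = inj₂ (inj₁ refl)
even-range {+ 3} _ _ d = contradiction d (from-no (+ 2 ∣? + 3))
even-range {+ 4} _ _ _ = inj₂ (inj₂ refl)
even-range {+ (suc (suc (suc (suc (suc _)))))} _ (+≤+ (s≤s (s≤s (s≤s (s≤s ()))))) _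

2∣4 : + 2 ∣ + 4
2∣4 = divides (+ 2) refl

doubly-even-range : ∀ {z} → 0ℤ ≤ z → z ≤ + 4 → + 4 ∣ z → z ≡ + 0 ⊎ z ≡ + 4
doubly-even-range 0≤z z≤4 d with even-range 0≤z z≤4 (∣-trans 2∣4 d)
... | inj₁ e           = inj₁ e
... | inj₂ (inj₂ e)    = inj₂ e
... | inj₂ (inj₁ refl) = contradiction d (from-no (+ 4 ∣? + 2))

even-mod4 : ∀ {z} → + 2 ∣ z → + 4 ∣ z ⊎ + 4 ∣ z - + 2
even-mod4 {z} (divides q z≡) with q %ℕ 2 | q /ℕ 2 | a≡a%ℕn+[a/ℕn]*n q 2 | n%ℕd<d q 2
... | 0 | p | q≡ | _ = inj₁ (divides p (trans z≡ (trans (cong (_* + 2) q≡) (identity p))))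
  where
  identity : ∀ p → (+ 0 + p * + 2) * + 2 ≡ p * + 4
  identity = solve-∀
... | 1 | p | q≡ | _ = inj₂ (divides p (trans (cong (_- + 2) (trans z≡ (cong (_* + 2) q≡))) (identity p)))
  where
  identity : ∀ p → (+ 1 + p * + 2) * + 2 - + 2 ≡ p * + 4
  identity = solve-∀
... | suc (suc _) | _ | _ | s≤s (s≤s ())

-- Estimates for the controller's choice

-- The two entries of the maximum have mean `ℓ - 4`, so the larger is at least that.
control-monus4 : ∀ ℓ x → + ℓ - + 4 ≤ control ℓ x
control-monus4 ℓ x with ℤ.≤-total x (+ 4)
... | inj₁ x≤4 = ℤ.≤-trans (≤-by-difference x≤4 (identity (+ ℓ) x)) (ℤ.i≤i⊔j _ _)
  where
  identity : ∀ l x → (l - x) - (l - + 4) ≡ + 4 - x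
  identity = solve-∀
... | inj₂ 4≤x = ℤ.≤-trans (≤-by-difference 4≤x (identity (+ ℓ) x)) (ℤ.i≤j⊔i (+ ℓ - x) _)
  where
  identity : ∀ l x → ((l - + 8) + x) - (l - + 4) ≡ x - + 4
  identity = solve-∀

control-0 : ∀ ℓ → control ℓ 0ℤ ≡ + ℓ
control-0 ℓ = trans (ℤ.i≥j⇒i⊔j≡i (≤-by-difference (+≤+ (z≤n {8})) (identity (+ ℓ)))) (ℤ.+-identityʳ (+ ℓ))
  where
  identity : ∀ l → (l - 0ℤ) - ((l - + 8) + 0ℤ) ≡ + 8 - 0ℤ
  identity = solve-∀

-- Double-dealing exceeds taking everything by `2x - 8`, which is non-negative from 4 on.
control-≥4 : ∀ ℓ {x} → + 4 ≤ x → control ℓ x ≡ x + (+ ℓ - + 8)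
control-≥4 ℓ {x} 4≤x = trans
  (ℤ.i≤j⇒i⊔j≡j (≤-by-difference (ℤ.+-mono-≤ 4≤x 4≤x) (identity (+ ℓ) x)))
  (ℤ.+-comm (+ ℓ - + 8) x)
  where
  identity : ∀ l x → ((l - + 8) + x) - (l - x) ≡ (x + x) - (+ 4 + + 4)
  identity = solve-∀

control-≤4 : ∀ ℓ {x} → + ℓ - + 4 ≤ x → x ≤ + 12 - + ℓ → control ℓ x ≤ + 4
control-≤4 ℓ {x} lower upper = ℤ.⊔-lub
  (≤-by-difference lower (identity₁ (+ ℓ) x)) (≤-by-difference upper (identity₂ (+ ℓ) x))
  where
  identity₁ : ∀ l x → + 4 - (l - x) ≡ x - (l - + 4)
  identity₁ = solve-∀

  identity₂ : ∀ l x → + 4 - ((l - + 8) + x) ≡ (+ 12 - l) - x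
  identity₂ = solve-∀

-- Short loops and 4-loops

≥6 : ∀ {n} → 2 ℕ.∣ n → 4 ℕ.≤ n → n ≢ 4 → 6 ℕ.≤ n
≥6 {n} even 4≤n n≢4 = ℕ.≤∧≢⇒< (ℕ.≤∧≢⇒< 4≤n (n≢4 ∘ sym)) (λ { refl → from-no (2 ℕ.∣? 5) even })

≥8 : ∀ {n} → 2 ℕ.∣ n → 6 ℕ.≤ n → n ≢ 6 → 8 ℕ.≤ n
≥8 {n} even 6≤n n≢6 = ℕ.≤∧≢⇒< (ℕ.≤∧≢⇒< 6≤n (n≢6 ∘ sym)) (λ { refl → from-no (2 ℕ.∣? 7) even })

all-remove : ∀ {P : Loop → Set} xs {ℓ ys} → All P (xs ++ ℓ ∷ ys) → P ℓ × All P (xs ++ ys)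
all-remove xs ps = All.head (All.++⁻ʳ xs ps) , All.++⁺ (All.++⁻ˡ xs ps) (All.tail (All.++⁻ʳ xs ps))

Split : (Loop → Set) → List Loop → Set
Split P ℓs = ∃ λ xs → ∃ λ ℓ → ∃ λ ys → ℓs ≡ xs ++ ℓ ∷ ys × P ℓ

split-any : ∀ {P : Loop → Set} {ℓs} → Any P ℓs → Split P ℓs
split-any any with find any
... | ℓ , ℓ∈ , p with ∈-∃++ ℓ∈
...   | xs , ys , eq = xs , ℓ , ys , eq , p

-- Decides which loop to open in the upper bounds. In case `six` the absence of 4-loops is recorded,
-- because it keeps the value of the rest, if non-empty, at 2 or more.
data Shortest (ℓs : List Loop) : Set where
  four  : Split (λ ℓ → length ℓ ≡ 4) ℓs → Shortest ℓs
  six   : All (λ ℓ → 6 ℕ.≤ length ℓ) ℓs → Split (λ ℓ → length ℓ ≡ 6) ℓs → Shortest ℓs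
  eight : All (λ ℓ → 8 ℕ.≤ length ℓ) ℓs → Shortest ℓs

≥6-all : ∀ {ℓs} → Even ℓs → ¬ Any (λ ℓ → length ℓ ≡ 4) ℓs → All (λ ℓ → 6 ℕ.≤ length ℓ) ℓs
≥6-all even no4 = All.zipWith (λ { {ℓ} (e , ℓ≢4) → ≥6 e (4≤length ℓ) ℓ≢4 }) (even , All.¬Any⇒All¬ _ no4)

shortest : ∀ {ℓs} → Even ℓs → Shortest ℓs
shortest {ℓs} even with any? (λ ℓ → length ℓ ℕ.≟ 4) ℓs
... | yes any4 = four (split-any any4)
... | no no4 with any? (λ ℓ → length ℓ ℕ.≟ 6) ℓs
...   | yes any6 = six (≥6-all even no4) (split-any any6)
...   | no no6   = eight (All.zipWith (λ { (e , 6≤ , ≢6) → ≥8 e 6≤ ≢6 })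
                     (even , All.zip (≥6-all even no4 , All.¬Any⇒All¬ _ no6)))

excess-≥0 : ∀ {ℓs} → All (λ ℓ → 8 ℕ.≤ length ℓ) ℓs → 0ℤ ≤ excess ℓs
excess-≥0 []         = ℤ.≤-refl
excess-≥0 (8≤ ∷ 8≤s) = ℤ.+-mono-≤ (ℤ.i≤j⇒0≤j-i (+≤+ 8≤)) (excess-≥0 8≤s)

cv-≥8 : ∀ {ℓs} → All (λ ℓ → 8 ℕ.≤ length ℓ) ℓs → ℓs ≢ [] → + 8 ≤ cv ℓs
cv-≥8 8≤s ne = subst (+ 8 ≤_) (sym (cv-nonempty ne)) (ℤ.+-monoʳ-≤ (+ 8) (excess-≥0 8≤s))

four? : (ℓ : Loop) → Dec (length ℓ ≡ 4)
four? ℓ = length ℓ ℕ.≟ 4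

removeFourLoops-remove : ∀ xs {ℓ} ys → length ℓ ≡ 4 → removeFourLoops (xs ++ ℓ ∷ ys) ≡ removeFourLoops (xs ++ ys)
removeFourLoops-remove xs {ℓ} ys ≡4 = begin
  removeFourLoops (xs ++ ℓ ∷ ys)                        ≡⟨ List.filter-++ (¬? ∘ four?) xs (ℓ ∷ ys) ⟩
  removeFourLoops xs ++ removeFourLoops (ℓ ∷ ys)        ≡⟨ cong (removeFourLoops xs ++_) (List.filter-reject (¬? ∘ four?) (λ ≢4 → ≢4 ≡4)) ⟩
  removeFourLoops xs ++ removeFourLoops ys              ≡⟨ List.filter-++ (¬? ∘ four?) xs ys ⟨
  removeFourLoops (xs ++ ys)                            ∎
  where open ≡-Reasoning

fourLoops-remove : ∀ xs {ℓ} ys → length ℓ ≡ 4 → fourLoops (xs ++ ℓ ∷ ys) ≡ suc (fourLoops (xs ++ ys))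
fourLoops-remove xs {ℓ} ys ≡4 = begin
  List.length (fours (xs ++ ℓ ∷ ys))          ≡⟨ cong List.length (List.filter-++ four? xs (ℓ ∷ ys)) ⟩
  List.length (fours xs ++ fours (ℓ ∷ ys))    ≡⟨ cong (λ zs → List.length (fours xs ++ zs)) (List.filter-accept four? ≡4) ⟩
  List.length (fours xs ++ ℓ ∷ fours ys)      ≡⟨ ↭-length (shift ℓ (fours xs) (fours ys)) ⟩
  suc (List.length (fours xs ++ fours ys))    ≡⟨ cong (suc ∘ List.length) (List.filter-++ four? xs ys) ⟨
  suc (List.length (fours (xs ++ ys)))        ∎
  where
  open ≡-Reasoning
  fours : List Loop → List Loop
  fours = List.filter four?

fours-filter : ∀ ℓs → (Split (λ ℓ → length ℓ ≡ 4) ℓs × 1 ℕ.≤ fourLoops ℓs)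
                    ⊎ (¬ Any (λ ℓ → length ℓ ≡ 4) ℓs × fourLoops ℓs ≡ 0 × removeFourLoops ℓs ≡ ℓs)
fours-filter ℓs with any? four? ℓs
... | yes any4 with xs , ℓ , ys , refl , ≡4 ← split-any any4 =
      inj₁ ((xs , ℓ , ys , refl , ≡4) , subst (1 ℕ.≤_) (sym (fourLoops-remove xs ys ≡4)) (s≤s z≤n))
... | no no4 = inj₂ ( no4
                    , cong List.length (List.filter-none four? (All.¬Any⇒All¬ ℓs no4))
                    , List.filter-all (¬? ∘ four?) (All.¬Any⇒All¬ ℓs no4))

excess-removeFourLoops : ∀ ℓs → excess ℓs ≡ excess (removeFourLoops ℓs) - + 4 * + fourLoops ℓs
excess-removeFourLoops []       = refl
excess-removeFourLoops (ℓ ∷ ℓs) with four? ℓ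
... | yes ≡4 = begin
  (+ length ℓ - + 8) + excess ℓs
    ≡⟨ cong₂ (λ l e → (+ l - + 8) + e) ≡4 (excess-removeFourLoops ℓs) ⟩
  (+ 4 - + 8) + (excess (removeFourLoops ℓs) - + 4 * + fourLoops ℓs)
    ≡⟨ identity (excess (removeFourLoops ℓs)) (+ fourLoops ℓs) ⟩
  excess (removeFourLoops ℓs) - + 4 * + suc (fourLoops ℓs)
    ≡⟨ cong₂ (λ K f → excess K - + 4 * + f) (removeFourLoops-remove [] ℓs ≡4) (fourLoops-remove [] ℓs ≡4) ⟨
  excess (removeFourLoops (ℓ ∷ ℓs)) - + 4 * + fourLoops (ℓ ∷ ℓs) ∎
  where
  open ≡-Reasoning
  identity : ∀ e f → (+ 4 - + 8) + (e - + 4 * f) ≡ e - + 4 * (+ 1 + f)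
  identity = solve-∀
... | no ≢4 = begin
  (+ length ℓ - + 8) + excess ℓs
    ≡⟨ cong (_+_ (+ length ℓ - + 8)) (excess-removeFourLoops ℓs) ⟩
  (+ length ℓ - + 8) + (excess (removeFourLoops ℓs) - + 4 * + fourLoops ℓs)
    ≡⟨ ℤ.+-assoc (+ length ℓ - + 8) (excess (removeFourLoops ℓs)) _ ⟨
  excess (ℓ ∷ removeFourLoops ℓs) - + 4 * + fourLoops ℓs
    ≡⟨ cong₂ (λ K fs → excess K - + 4 * + List.length fs)
         (List.filter-accept (¬? ∘ four?) ≢4) (List.filter-reject four? ≢4) ⟨
  excess (removeFourLoops (ℓ ∷ ℓs)) - + 4 * + fourLoops (ℓ ∷ ℓs) ∎
  where open ≡-Reasoning

-- If all loops are 4-loops, the constant 8 is present in `cv ℓs` but not in the controlled value of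
-- the empty rest; hence the separate alternative.
cv-removeFourLoops : ∀ {ℓs} → ℓs ≢ [] →
  (removeFourLoops ℓs ≡ [] × cv ℓs ≡ + 8 - + 4 * + fourLoops ℓs)
  ⊎ cv ℓs ≡ cv (removeFourLoops ℓs) - + 4 * + fourLoops ℓs
cv-removeFourLoops {ℓs} ne with []-or-≢[] (removeFourLoops ℓs)
... | inj₁ K≡[] = inj₁ (K≡[] , trans (cv-nonempty ne) (trans (cong (_+_ (+ 8)) (excess-removeFourLoops ℓs))
        (trans (cong (λ K → + 8 + (excess K - + 4 * + fourLoops ℓs)) K≡[]) (identity (+ fourLoops ℓs)))))
  where
  identity : ∀ f → + 8 + (0ℤ - + 4 * f) ≡ + 8 - + 4 * f
  identity = solve-∀
... | inj₂ K≢[] = inj₂ (trans (cv-nonempty ne) (trans (cong (_+_ (+ 8)) (excess-removeFourLoops ℓs))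
        (trans (sym (ℤ.+-assoc (+ 8) (excess (removeFourLoops ℓs)) _))
               (cong (_- + 4 * + fourLoops ℓs) (sym (cv-nonempty K≢[]))))))

even-removeFourLoops : ∀ {ℓs} → Even ℓs → Even (removeFourLoops ℓs)
even-removeFourLoops = All.filter⁺ (λ ℓ → ¬? (length ℓ ℕ.≟ 4))

length-≢[] : {A : Set} {xs : List A} {n : ℕ} → List.length xs ≡ suc n → xs ≢ []
length-≢[] () refl

-- Consequences of the recursion

-- From here on the game itself does not enter: a function that is bounded by every opening and
-- attained by one is all that is used.
module Evaluation
  (F : List Loop → ℤ)
  (F-[] : F [] ≡ 0ℤ)
  (F-≤ : ∀ xs ℓ ys → F (xs ++ ℓ ∷ ys) ≤ control (length ℓ) (F (xs ++ ys)))
  (F-attained : ∀ ℓs → ℓs ≢ [] → ∃ λ xs → ∃ λ ℓ → ∃ λ ys → ℓs ≡ xs ++ ℓ ∷ ys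
                                    × F ℓs ≡ control (length ℓ) (F (xs ++ ys)))
  where

  -- Used with 4 for non-negativity, and with 6 for the bound 2 in the absence of 4-loops.
  F-≥ : ∀ {b ℓs} → All (λ ℓ → b ℕ.≤ length ℓ) ℓs → ℓs ≢ [] → + b - + 4 ≤ F ℓs
  F-≥ {b} {ℓs} b≤ ne with xs , ℓ , ys , refl , attained ← F-attained ℓs ne =
    ℤ.≤-trans (ℤ.+-monoˡ-≤ (- + 4) (+≤+ (proj₁ (all-remove xs b≤))))
              (ℤ.≤-trans (control-monus4 (length ℓ) (F (xs ++ ys))) (ℤ.≤-reflexive (sym attained)))

  F-≥0 : ∀ ℓs → 0ℤ ≤ F ℓs
  F-≥0 []      = ℤ.≤-reflexive (sym F-[])
  F-≥0 (_ ∷ _) = F-≥ {4} (All.universal 4≤length _) λ ()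

  F-single : ∀ xs ℓ ys → xs ++ ys ≡ [] → F (xs ++ ℓ ∷ ys) ≤ cv (xs ++ ℓ ∷ ys)
  F-single xs ℓ ys empty = ℤ.≤-trans (F-≤ xs ℓ ys) (ℤ.≤-reflexive
    (trans (cong (control (length ℓ)) (trans (cong F empty) F-[]))
           (trans (control-0 (length ℓ)) (sym (cv-single xs ℓ ys empty)))))

  -- The controller can always double-deal: whichever loop is opened, this yields `ℓ - 8` plus the
  -- value of the rest, and the last loop is taken whole.
  cv-≤-F : ∀ n ℓs → List.length ℓs ≡ n → cv ℓs ≤ F ℓs
  cv-≤-F zero    []      _   = ℤ.≤-reflexive (sym F-[])
  cv-≤-F (suc n) ℓs len with F-attained ℓs (length-≢[] len)
  ... | xs , ℓ , ys , refl , attained rewrite attained with []-or-≢[] (xs ++ ys)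
  ...   | inj₁ empty = ℤ.≤-reflexive (trans (cv-single xs ℓ ys empty)
            (trans (sym (control-0 (length ℓ))) (cong (control (length ℓ)) (sym (trans (cong F empty) F-[])))))
  ...   | inj₂ ne = begin
          cv (xs ++ ℓ ∷ ys)                          ≡⟨ cv-remove xs ℓ ys ne ⟩
          cv (xs ++ ys) + (+ length ℓ - + 8)         ≤⟨ ℤ.+-monoˡ-≤ (+ length ℓ - + 8) (cv-≤-F n (xs ++ ys) (length-remove xs len)) ⟩
          F (xs ++ ys) + (+ length ℓ - + 8)          ≡⟨ ℤ.+-comm (F (xs ++ ys)) _ ⟩
          (+ length ℓ - + 8) + F (xs ++ ys)          ≤⟨ ℤ.i≤j⊔i (+ length ℓ - F (xs ++ ys)) _ ⟩
          control (length ℓ) (F (xs ++ ys))          ∎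
    where open ℤ.≤-Reasoning

  -- Modulo 4, taking all of a loop and double-dealing have the same effect, since values are even.
  F-mod4 : ∀ n ℓs → List.length ℓs ≡ n → Even ℓs → + 4 ∣ F ℓs - cv ℓs
  F-mod4 zero    []        _   _ = divides (+ 0) (cong (_- 0ℤ) F-[])
  F-mod4 (suc n) ℓs len even with F-attained ℓs (length-≢[] len)
  ... | xs , ℓ , ys , refl , attained rewrite attained =
    Sum.[ (λ e → ∣-resp-≡ (trans (cong (_- c) e) (identity₁ ∣ℓ∣ x c c′)) takeAll)
        , (λ e → ∣-resp-≡ (trans (cong (_- c) e) (identity₂ ∣ℓ∣ x c c′)) doubleDeal) ]′
      (ℤ.⊔-sel (∣ℓ∣ - x) ((∣ℓ∣ - + 8) + x))
    where
    ∣ℓ∣ x c c′ : ℤ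
    ∣ℓ∣ = + length ℓ
    x   = F (xs ++ ys)
    c   = cv (xs ++ ℓ ∷ ys)
    c′  = cv (xs ++ ys)

    even′ : Even (xs ++ ys)
    even′ = proj₂ (all-remove xs even)

    -- `cv` changes by `ℓ` when the last loop goes and by `ℓ - 8` otherwise; modulo 4 these agree.
    removal : + 4 ∣ c - (c′ + ∣ℓ∣)
    removal with []-or-≢[] (xs ++ ys)
    ... | inj₁ empty = divides (+ 0) (trans (cong₂ (λ a b → a - (b + ∣ℓ∣)) (cv-single xs ℓ ys empty) (cong cv empty)) (identity ∣ℓ∣))
      where
      identity : ∀ l → l - (0ℤ + l) ≡ 0ℤ
      identity = solve-∀
    ... | inj₂ ne = divides (- + 2) (trans (cong (_- (c′ + ∣ℓ∣)) (cv-remove xs ℓ ys ne)) (identity c′ ∣ℓ∣))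
      where
      identity : ∀ c′ l → (c′ + (l - + 8)) - (c′ + l) ≡ - + 8
      identity = solve-∀

    hyp : + 4 ∣ x - c′
    hyp = F-mod4 n (xs ++ ys) (length-remove xs len) even′

    -- Taking all reverses the sign of the rest, at the price of the term `2 * c′`; it is a multiple
    -- of 4 because `c′` is even.
    takeAll : + 4 ∣ - ((c - (c′ + ∣ℓ∣)) + ((x - c′) + + 2 * c′))
    takeAll = ∣m⇒∣-m (∣m∣n⇒∣m+n removal (∣m∣n⇒∣m+n hyp (*-monoʳ-∣ (+ 2) (cv-even even′))))

    doubleDeal : + 4 ∣ (x - c′) - ((c - (c′ + ∣ℓ∣)) + + 8)
    doubleDeal = ∣m∣n⇒∣m-n hyp (∣m∣n⇒∣m+n removal (divides (+ 2) refl))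

    identity₁ : ∀ l x c c′ → (l - x) - c ≡ - ((c - (c′ + l)) + ((x - c′) + + 2 * c′))
    identity₁ = solve-∀

    identity₂ : ∀ l x c c′ → ((l - + 8) + x) - c ≡ (x - c′) - ((c - (c′ + l)) + + 8)
    identity₂ = solve-∀

  F-even : ∀ {ℓs} → Even ℓs → + 2 ∣ F ℓs
  F-even {ℓs} even = ∣-resp-≡ (identity (F ℓs) (cv ℓs))
    (∣m∣n⇒∣m+n (∣-trans 2∣4 (F-mod4 _ ℓs refl even)) (cv-even even))
    where
    identity : ∀ x c → x ≡ (x - c) + c
    identity = solve-∀

  -- Opening a loop of length `ℓ ≤ 6` leaves a controlled value `c + 8 - ℓ ≥ 4` unless nothing
  -- remains; if all loops have length at least 8, any non-empty rest has controlled value at least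
  -- 8. From 4 on, double-dealing is the controller's best plan, and it yields exactly `c`.
  F-≡-cv : ∀ n ℓs → List.length ℓs ≡ n → Even ℓs → + 2 ≤ cv ℓs → F ℓs ≡ cv ℓs
  F-≡-cv zero    []        _   _    _   = F-[]
  F-≡-cv (suc n) ℓs        len even 2≤c = ℤ.≤-antisym (upper (shortest even)) (cv-≤-F (suc n) ℓs len)
    where
    via : ∀ xs ℓ ys → ℓs ≡ xs ++ ℓ ∷ ys → xs ++ ys ≡ [] ⊎ (xs ++ ys ≢ [] × + 4 ≤ cv (xs ++ ys)) → F ℓs ≤ cv ℓs
    via xs ℓ ys refl (inj₁ empty)       = F-single xs ℓ ys empty
    via xs ℓ ys refl (inj₂ (ne , 4≤c′)) = begin
      F (xs ++ ℓ ∷ ys)                       ≤⟨ F-≤ xs ℓ ys ⟩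
      control (length ℓ) (F (xs ++ ys))      ≡⟨ cong (control (length ℓ)) (F-≡-cv n (xs ++ ys) (length-remove xs len)
                                                   (proj₂ (all-remove xs even)) (ℤ.≤-trans (+≤+ (s≤s (s≤s z≤n))) 4≤c′)) ⟩
      control (length ℓ) (cv (xs ++ ys))     ≡⟨ control-≥4 (length ℓ) 4≤c′ ⟩
      cv (xs ++ ys) + (+ length ℓ - + 8)     ≡⟨ cv-remove xs ℓ ys ne ⟨
      cv (xs ++ ℓ ∷ ys)                      ∎
      where open ℤ.≤-Reasoning

    short : ∀ xs ℓ ys → ℓs ≡ xs ++ ℓ ∷ ys → length ℓ ℕ.≤ 6 → F ℓs ≤ cv ℓs
    short xs ℓ ys refl ℓ≤6 = via xs ℓ ys refl (Sum.map₂ (λ ne → ne ,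
      ≤-by-difference (ℤ.+-mono-≤ 2≤c (+≤+ ℓ≤6)) (trans (identity (cv (xs ++ ys)) (+ length ℓ))
        (cong (λ c → (c + + 6) - (+ 2 + + length ℓ)) (sym (cv-remove xs ℓ ys ne)))))
      ([]-or-≢[] (xs ++ ys)))
      where
      identity : ∀ c′ l → c′ - + 4 ≡ ((c′ + (l - + 8)) + + 6) - (+ 2 + l)
      identity = solve-∀

    upper : Shortest ℓs → F ℓs ≤ cv ℓs
    upper (four (xs , ℓ , ys , eq , ≡4))   = short xs ℓ ys eq (ℕ.≤-trans (ℕ.≤-reflexive ≡4) (s≤s (s≤s (s≤s (s≤s z≤n)))))
    upper (six _ (xs , ℓ , ys , eq , ≡6))  = short xs ℓ ys eq (ℕ.≤-reflexive ≡6)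
    upper (eight 8≤s) = long ℓs refl len 8≤s
      where
      long : ∀ ms → ℓs ≡ ms → List.length ms ≡ suc n → All (λ ℓ → 8 ℕ.≤ length ℓ) ms → F ℓs ≤ cv ℓs
      long (ℓ ∷ ys) eq _ (_ ∷ 8≤s) = via [] ℓ ys eq (Sum.map₂ (λ ne → ne ,
        ℤ.≤-trans (+≤+ (s≤s (s≤s (s≤s (s≤s z≤n))))) (cv-≥8 8≤s ne)) ([]-or-≢[] ys))

  -- The hypothesis is `cv ℓs ≤ + 4` and not `≤ 0ℤ` because removing a 4-loop raises the controlled
  -- value by 4. For a shortest loop of length 4 or 6 and a non-empty rest, the value of the rest
  -- lies between `ℓ - 4` and 4, and there both plans yield at most 4.
  F-≤4 : ∀ n ℓs → List.length ℓs ≡ n → Even ℓs → ℓs ≢ [] → cv ℓs ≤ + 4 → F ℓs ≤ + 4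
  F-≤4 zero    []  _   _    ne _   = contradiction refl ne
  F-≤4 (suc n) ℓs  len even ne c≤4 with even-split (cv-even even)
  ... | inj₂ 2≤c = ℤ.≤-trans (ℤ.≤-reflexive (F-≡-cv (suc n) ℓs len even 2≤c)) c≤4
  ... | inj₁ c≤0 = upper (shortest even)
    where
    via : ∀ xs ℓ ys → ℓs ≡ xs ++ ℓ ∷ ys → 4 ℕ.≤ length ℓ → length ℓ ℕ.≤ 8 →
          (xs ++ ys ≢ [] → + length ℓ - + 4 ≤ F (xs ++ ys)) → F ℓs ≤ + 4
    via xs ℓ ys refl 4≤ℓ ℓ≤8 lower with []-or-≢[] (xs ++ ys)
    ... | inj₁ empty = ℤ.≤-trans (F-single xs ℓ ys empty) c≤4
    ... | inj₂ ne′   = ℤ.≤-trans (F-≤ xs ℓ ys) (control-≤4 (length ℓ) (lower ne′)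
            (ℤ.≤-trans (F-≤4 n (xs ++ ys) (length-remove xs len) (proj₂ (all-remove xs even)) ne′ c′≤4)
                       (≤-by-difference (+≤+ ℓ≤8) (identity′ (+ length ℓ)))))
      where
      c′≤4 : cv (xs ++ ys) ≤ + 4
      c′≤4 = ≤-by-difference (ℤ.+-mono-≤ c≤0 (+≤+ 4≤ℓ))
        (trans (identity (cv (xs ++ ys)) (+ length ℓ))
               (cong (λ c → (0ℤ + + length ℓ) - (c + + 4)) (sym (cv-remove xs ℓ ys ne′))))
        where
        identity : ∀ c′ l → + 4 - c′ ≡ (0ℤ + l) - ((c′ + (l - + 8)) + + 4)
        identity = solve-∀

      identity′ : ∀ l → (+ 12 - l) - + 4 ≡ + 8 - l
      identity′ = solve-∀

    upper : Shortest ℓs → F ℓs ≤ + 4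
    upper (four (xs , ℓ , ys , eq , ≡4)) = via xs ℓ ys eq (4≤length ℓ)
      (subst (ℕ._≤ 8) (sym ≡4) (ℕ.m≤m+n 4 4))
      (λ _ → subst (λ l → + l - + 4 ≤ F (xs ++ ys)) (sym ≡4) (F-≥0 (xs ++ ys)))
    upper (six 6≤s (xs , ℓ , ys , refl , ≡6)) = via xs ℓ ys refl (4≤length ℓ)
      (subst (ℕ._≤ 8) (sym ≡6) (ℕ.m≤m+n 6 2))
      (λ ne′ → subst (λ l → + l - + 4 ≤ F (xs ++ ys)) (sym ≡6) (F-≥ (proj₂ (all-remove xs 6≤s)) ne′))
    upper (eight 8≤s) = contradiction (ℤ.≤-trans (cv-≥8 8≤s ne) c≤0) λ { (+≤+ ()) }

  private
    Mod8 : List Loop → Set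
    Mod8 ℓs = + 8 ∣ F ℓs - (F (removeFourLoops ℓs) + + (4 ℕ.* fourLoops ℓs))

  -- Each 4-loop contributes -4 to `cv`, which is 4 modulo 8; the additional 8 that appears when
  -- only 4-loops are present vanishes modulo 8.
  Mod8-cv : ∀ ℓs → Even ℓs → ℓs ≢ [] → F ℓs ≡ cv ℓs → + 2 ≤ cv ℓs → Mod8 ℓs
  Mod8-cv ℓs even ne F≡c 2≤c rewrite F≡c | ℤ.pos-* 4 (fourLoops ℓs) with cv-removeFourLoops ne
  ... | inj₁ (K≡[] , c≡) = ∣-resp-≡ (trans (cong₂ (λ a b → a - (b + + 4 * f)) c≡ (trans (cong F K≡[]) F-[])) (identity f))
          (∣m∣n⇒∣m+n (divides (+ 1) refl) (∣m⇒∣-m (*-monoʳ-∣ (+ 8) (divides {k = + 1} f (sym (ℤ.*-identityʳ f))))))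
    where
    f : ℤ
    f = + fourLoops ℓs
    identity : ∀ f → (+ 8 - + 4 * f) - (0ℤ + + 4 * f) ≡ + 8 + - (+ 8 * f)
    identity = solve-∀
  ... | inj₂ c≡ = ∣-resp-≡ (trans (cong₂ (λ a b → a - (b + + 4 * f)) c≡ F-K) (identity (cv K) f))
          (∣m⇒∣-m (*-monoʳ-∣ (+ 8) (divides {k = + 1} f (sym (ℤ.*-identityʳ f)))))
    where
    f : ℤ
    f = + fourLoops ℓs

    K : List Loop
    K = removeFourLoops ℓs

    2≤cK : + 2 ≤ cv K
    2≤cK = ≤-by-difference (ℤ.+-mono-≤ 2≤c (+≤+ (z≤n {4 ℕ.* fourLoops ℓs})))
      (trans (identity (cv K) f) (cong₂ (λ a b → (a + b) - (+ 2 + 0ℤ)) (sym c≡) (sym (ℤ.pos-* 4 (fourLoops ℓs)))))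
      where
      identity : ∀ k f → k - + 2 ≡ ((k - + 4 * f) + + 4 * f) - (+ 2 + 0ℤ)
      identity = solve-∀

    F-K : F K ≡ cv K
    F-K = F-≡-cv _ K refl (even-removeFourLoops even) 2≤cK

    identity : ∀ k f → (k - + 4 * f) - (k + + 4 * f) ≡ - (+ 8 * f)
    identity = solve-∀

  -- Induction on the 4-loops. Each step replaces the value `x` of the rest by `4 - x`, which agrees
  -- with `x + 4` modulo 8 precisely when 4 divides `x`; divisibility of the value of the
  -- 4-loop-free part by 4 ensures this.
  F-mod8 : ∀ n ℓs → List.length ℓs ≡ n → Even ℓs → + 4 ∣ F (removeFourLoops ℓs) → Mod8 ℓs
  F-mod8 n ℓs len even 4∣K with fours-filter ℓs
  ... | inj₂ (_ , f≡0 , K≡) = ∣-resp-≡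
          (trans (cong₂ (λ K f → F ℓs - (F K + + (4 ℕ.* f))) K≡ f≡0) (identity (F ℓs))) (divides (+ 0) refl)
    where
    identity : ∀ x → x - (x + 0ℤ) ≡ 0ℤ
    identity = solve-∀
  F-mod8 zero    [] len even 4∣K | inj₁ (([] , _ , _ , () , _) , _)
  F-mod8 zero    [] len even 4∣K | inj₁ ((_ ∷ _ , _ , _ , () , _) , _)
  F-mod8 (suc n) ℓs len even 4∣K | inj₁ (split , _) with even-split (cv-even even)
  ... | inj₂ 2≤c = Mod8-cv ℓs even (length-≢[] len) (F-≡-cv (suc n) ℓs len even 2≤c) 2≤c
  ... | inj₁ c≤0 = go (F-attained ℓs (length-≢[] len)) split
    where
    ne : ℓs ≢ []
    ne = length-≢[] len

    c≤4 : cv ℓs ≤ + 4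
    c≤4 = ℤ.≤-trans c≤0 (+≤+ z≤n)

    -- Removing a 4-loop exchanges the values 0 and 4.
    exchange : ∀ xs ℓ ys → ℓs ≡ xs ++ ℓ ∷ ys → length ℓ ≡ 4 →
               (F (xs ++ ys) ≡ + 0 ⊎ F (xs ++ ys) ≡ + 4)
             × + 4 ∣ F ℓs
             × (F ℓs ≡ + 4 - F (xs ++ ys) → Mod8 ℓs)
    exchange xs ℓ ys refl ≡4 = x≡ , 4∣F , result
      where
      K : List Loop
      K = removeFourLoops (xs ++ ys)

      even′ : Even (xs ++ ys)
      even′ = proj₂ (all-remove xs even)

      ne′ : xs ++ ys ≢ []
      -- A lone 4-loop has controlled value 4, which is positive.
      ne′ empty = contradiction (subst (_≤ 0ℤ) (trans (cv-single xs ℓ ys empty) (cong +_ ≡4)) c≤0) λ { (+≤+ ()) }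

      c≡ : cv (xs ++ ℓ ∷ ys) ≡ cv (xs ++ ys) - + 4
      c≡ = trans (cv-remove xs ℓ ys ne′) (cong (λ l → cv (xs ++ ys) + (+ l - + 8)) ≡4)

      4∣K′ : + 4 ∣ F K
      4∣K′ = subst (λ K → + 4 ∣ F K) (removeFourLoops-remove xs ys ≡4) 4∣K

      hyp : Mod8 (xs ++ ys)
      hyp = F-mod8 n (xs ++ ys) (length-remove xs len) even′ 4∣K′

      4∣x : + 4 ∣ F (xs ++ ys)
      4∣x = ∣-resp-≡ (identity (F (xs ++ ys)) (F K) (+ (4 ℕ.* fourLoops (xs ++ ys))))
        (∣m∣n⇒∣m+n (∣-trans (divides (+ 2) refl) hyp)
           (∣m∣n⇒∣m+n 4∣K′ (divides (+ fourLoops (xs ++ ys)) (trans (ℤ.pos-* 4 (fourLoops (xs ++ ys))) (ℤ.*-comm (+ 4) (+ fourLoops (xs ++ ys)))))))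
        where
        identity : ∀ x k g → x ≡ (x - (k + g)) + (k + g)
        identity = solve-∀

      x≤4 : F (xs ++ ys) ≤ + 4
      x≤4 = F-≤4 n (xs ++ ys) (length-remove xs len) even′ ne′
        (≤-by-difference c≤0 (trans (identity (cv (xs ++ ys))) (cong (λ c → 0ℤ - c) (sym c≡))))
        where
        identity : ∀ c′ → + 4 - c′ ≡ 0ℤ - (c′ - + 4)
        identity = solve-∀

      x≡ : F (xs ++ ys) ≡ + 0 ⊎ F (xs ++ ys) ≡ + 4
      x≡ = doubly-even-range (F-≥0 (xs ++ ys)) x≤4 4∣x

      4∣F : + 4 ∣ F (xs ++ ℓ ∷ ys)
      4∣F = ∣-resp-≡ (trans (identity (F (xs ++ ℓ ∷ ys)) (cv (xs ++ ys)) (F (xs ++ ys)))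
               (cong (λ c → ((F (xs ++ ℓ ∷ ys) - c) - (F (xs ++ ys) - cv (xs ++ ys))) + (F (xs ++ ys) - + 4)) (sym c≡)))
        (∣m∣n⇒∣m+n (∣m∣n⇒∣m-n (F-mod4 _ (xs ++ ℓ ∷ ys) refl even) (F-mod4 _ (xs ++ ys) refl even′))
                    (∣m∣n⇒∣m-n 4∣x (divides (+ 1) refl)))
        where
        identity : ∀ y c′ x → y ≡ ((y - (c′ - + 4)) - (x - c′)) + (x - + 4)
        identity = solve-∀

      result : F (xs ++ ℓ ∷ ys) ≡ + 4 - F (xs ++ ys) → Mod8 (xs ++ ℓ ∷ ys)
      -- The change of sign costs `2 * F K`, a multiple of 8 by `4∣K′`.
      result F≡ = ∣-resp-≡
        (trans (cong₂ (λ y z → y - z) F≡ (cong₂ (λ K f → F K + f) (removeFourLoops-remove xs ys ≡4)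
                        (trans (cong (λ f → + (4 ℕ.* f)) (fourLoops-remove xs ys ≡4))
                               (trans (ℤ.pos-* 4 (suc f)) refl))))
               (trans (identity (F (xs ++ ys)) (F K) (+ f))
                      (cong (λ g → - ((F (xs ++ ys) - (F K + g)) + + 2 * F K) - + 8 * + f) (sym (ℤ.pos-* 4 f)))))
        (∣m∣n⇒∣m-n (∣m⇒∣-m (∣m∣n⇒∣m+n hyp (*-monoʳ-∣ (+ 2) 4∣K′)))
                    (*-monoʳ-∣ (+ 8) (divides {k = + 1} (+ f) (sym (ℤ.*-identityʳ (+ f))))))
        where
        f : ℕ
        f = fourLoops (xs ++ ys)

        identity : ∀ x k f → (+ 4 - x) - (k + + 4 * (+ 1 + f)) ≡ - ((x - (k + + 4 * f)) + + 2 * k) - + 8 * f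
        identity = solve-∀

    go : (∃ λ xs → ∃ λ ℓ → ∃ λ ys → ℓs ≡ xs ++ ℓ ∷ ys × F ℓs ≡ control (length ℓ) (F (xs ++ ys))) →
         Split (λ ℓ → length ℓ ≡ 4) ℓs → Mod8 ℓs
    go (xs , ℓ , ys , eq , attained) (xs′ , ℓ′ , ys′ , eq′ , ≡4′) with length ℓ ℕ.≟ 4
    -- For a 4-loop, `control 4 x` is the distance of `x` from 4, so it equals `4 - x` at both
    -- possible values of `x`.
    ... | yes ≡4 with exchange xs ℓ ys eq ≡4
    ...   | inj₁ x≡ , _ , result = result (trans attained (trans (cong₂ control ≡4 x≡) (cong (λ x → + 4 - x) (sym x≡))))
    ...   | inj₂ x≡ , _ , result = result (trans attained (trans (cong₂ control ≡4 x≡) (cong (λ x → + 4 - x) (sym x≡))))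
    go (xs , ℓ , ys , eq , attained) (xs′ , ℓ′ , ys′ , eq′ , ≡4′) | no ≢4
      with exchange xs′ ℓ′ ys′ eq′ ≡4′
    ... | x≡ , 4∣F , result = conclude x≡ (doubly-even-range (F-≥0 ℓs) (F-≤4 (suc n) ℓs len even ne c≤4) 4∣F)
      where
      -- If the optimal opening is no 4-loop, its length is at least 6 and the value at least 2,
      -- hence 4. Opening the 4-loop instead cannot do better, so its rest is not worth 4, as
      -- `control 4 (+ 4)` is 0; it is worth 0, and the exchange holds for this 4-loop as well.
      2≤F : + 2 ≤ F ℓs
      2≤F = ℤ.≤-trans (ℤ.+-monoˡ-≤ (- + 4) (+≤+ (≥6 (proj₁ (all-remove xs (subst Even eq even))) (4≤length ℓ) ≢4)))
                      (ℤ.≤-trans (control-monus4 (length ℓ) (F (xs ++ ys))) (ℤ.≤-reflexive (sym attained)))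

      F≤control : F ℓs ≤ control 4 (F (xs′ ++ ys′))
      F≤control = subst₂ (λ zs l → F zs ≤ control l (F (xs′ ++ ys′))) (sym eq′) ≡4′ (F-≤ xs′ ℓ′ ys′)

      conclude : F (xs′ ++ ys′) ≡ + 0 ⊎ F (xs′ ++ ys′) ≡ + 4 → F ℓs ≡ + 0 ⊎ F ℓs ≡ + 4 → Mod8 ℓs
      conclude _         (inj₁ F≡0) = contradiction (subst (+ 2 ≤_) F≡0 2≤F) λ { (+≤+ ()) }
      conclude (inj₁ x≡) (inj₂ F≡4) = result (trans F≡4 (cong (λ x → + 4 - x) (sym x≡)))
      conclude (inj₂ x≡) (inj₂ F≡4) =
        contradiction (subst₂ _≤_ F≡4 (cong (control 4) x≡) F≤control) λ { (+≤+ ()) }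

-- The four claims, read off from the evaluation

theorem12 : (ℓs : List Loop) → All (λ ℓ → 2 ℕ.∣ length ℓ) ℓs →
    let G = loops ℓs
        K = loops (removeFourLoops ℓs)
        c = cv ℓs
        f = fourLoops ℓs
    in
      (All (λ ℓ → 8 ℕ.≤ length ℓ) ℓs → v G ≡ c)
    × (+ 2 ≤ c ⊎ ℓs ≡ [] → v G ≡ c)
    × (c ≤ 0ℤ → f ≡ 0 → ℓs ≢ [] →
         (v G ≡ + 2 ⊎ v G ≡ + 4) × v G ≡ c [mod 4 ])
    × (c ≤ 0ℤ → 1 ℕ.≤ f →
         (v K ≡ + 2 [mod 4 ] → v G ≡ + 2)
       × (¬ (v K ≡ + 2 [mod 4 ]) →
            (v G ≡ 0ℤ ⊎ v G ≡ + 4) × v G ≡ v K + + (4 ℕ.* f) [mod 8 ]))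
theorem12 ℓs even = part-a , part-b , part-c , part-d
  where
  open Evaluation (v ∘ loops) refl v-≤ v-attained

  K : List Loop
  K = removeFourLoops ℓs

  val : List Loop → ℤ
  val = v ∘ loops

  part-b : + 2 ≤ cv ℓs ⊎ ℓs ≡ [] → val ℓs ≡ cv ℓs
  part-b (inj₁ 2≤c)  = F-≡-cv _ ℓs refl even 2≤c
  part-b (inj₂ refl) = refl

  part-a : All (λ ℓ → 8 ℕ.≤ length ℓ) ℓs → val ℓs ≡ cv ℓs
  part-a 8≤s = part-b (Sum.swap (Sum.map₂ (λ ne → ℤ.≤-trans (+≤+ (s≤s (s≤s z≤n))) (cv-≥8 8≤s ne)) ([]-or-≢[] ℓs)))

  ≤4 : cv ℓs ≤ 0ℤ → ℓs ≢ [] → val ℓs ≤ + 4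
  ≤4 c≤0 ne = F-≤4 _ ℓs refl even ne (ℤ.≤-trans c≤0 (+≤+ z≤n))

  part-c : cv ℓs ≤ 0ℤ → fourLoops ℓs ≡ 0 → ℓs ≢ [] →
           (val ℓs ≡ + 2 ⊎ val ℓs ≡ + 4) × val ℓs ≡ cv ℓs [mod 4 ]
  part-c c≤0 f≡0 ne = range , ∣⇒∣ᵤ (F-mod4 _ ℓs refl even)
    where
    no4 : ¬ Any (λ ℓ → length ℓ ≡ 4) ℓs
    no4 with fours-filter ℓs
    ... | inj₁ (_ , 1≤f) = contradiction (subst (1 ℕ.≤_) f≡0 1≤f) λ ()
    ... | inj₂ (no4 , _) = no4

    range : val ℓs ≡ + 2 ⊎ val ℓs ≡ + 4
    range with even-range (F-≥0 ℓs) (≤4 c≤0 ne) (F-even even)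
    ... | inj₁ v≡0 = contradiction (subst (+ 2 ≤_) v≡0 (F-≥ (≥6-all even no4) ne)) λ { (+≤+ ()) }
    ... | inj₂ r   = r

  part-d : cv ℓs ≤ 0ℤ → 1 ℕ.≤ fourLoops ℓs →
           (val K ≡ + 2 [mod 4 ] → val ℓs ≡ + 2)
         × (¬ (val K ≡ + 2 [mod 4 ]) →
              (val ℓs ≡ 0ℤ ⊎ val ℓs ≡ + 4) × val ℓs ≡ val K + + (4 ℕ.* fourLoops ℓs) [mod 8 ])
  part-d c≤0 1≤f = two-mod4 , zero-mod4
    where
    ne : ℓs ≢ []
    ne refl = case 1≤f of λ ()

    4∣c-cK : + 4 ∣ cv ℓs - cv K
    4∣c-cK with cv-removeFourLoops ne
    ... | inj₁ (K≡[] , c≡) = divides (+ 2 - + fourLoops ℓs)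
            (trans (cong₂ _-_ c≡ (cong cv K≡[])) (identity (+ fourLoops ℓs)))
      where
      identity : ∀ f → (+ 8 - + 4 * f) - 0ℤ ≡ (+ 2 - f) * + 4
      identity = solve-∀
    ... | inj₂ c≡ = divides (- + fourLoops ℓs) (trans (cong (_- cv K) c≡) (identity (cv K) (+ fourLoops ℓs)))
      where
      identity : ∀ k f → (k - + 4 * f) - k ≡ (- f) * + 4
      identity = solve-∀

    4∣v-vK : + 4 ∣ val ℓs - val K
    4∣v-vK = ∣-resp-≡ (identity (val ℓs) (cv ℓs) (cv K) (val K))
      (∣m∣n⇒∣m-n (∣m∣n⇒∣m+n (F-mod4 _ ℓs refl even) 4∣c-cK) (F-mod4 _ K refl (even-removeFourLoops even)))
      where
      identity : ∀ x c k y → x - y ≡ ((x - c) + (c - k)) - (y - k)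
      identity = solve-∀

    two-mod4 : val K ≡ + 2 [mod 4 ] → val ℓs ≡ + 2
    two-mod4 vK≡2 with even-range (F-≥0 ℓs) (≤4 c≤0 ne) (F-even even)
                     | ∣-resp-≡ (identity (val ℓs) (val K)) (∣m∣n⇒∣m+n 4∣v-vK (∣ᵤ⇒∣ {i = val K - + 2} vK≡2))
      where
      identity : ∀ x y → x - + 2 ≡ (x - y) + (y - + 2)
      identity = solve-∀
    ... | inj₂ (inj₁ v≡2) | _ = v≡2
    ... | inj₁ v≡0        | d = contradiction (subst (λ x → + 4 ∣ x - + 2) v≡0 d) (from-no (+ 4 ∣? - + 2))
    ... | inj₂ (inj₂ v≡4) | d = contradiction (subst (λ x → + 4 ∣ x - + 2) v≡4 d) (from-no (+ 4 ∣? + 2))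

    zero-mod4 : ¬ (val K ≡ + 2 [mod 4 ]) →
                (val ℓs ≡ 0ℤ ⊎ val ℓs ≡ + 4) × val ℓs ≡ val K + + (4 ℕ.* fourLoops ℓs) [mod 8 ]
    zero-mod4 vK≢2 with even-mod4 (F-even (even-removeFourLoops even))
    ... | inj₂ 4∣vK-2 = contradiction (∣⇒∣ᵤ 4∣vK-2) vK≢2
    ... | inj₁ 4∣vK   =
          doubly-even-range (F-≥0 ℓs) (≤4 c≤0 ne) (∣-resp-≡ (identity (val ℓs) (val K)) (∣m∣n⇒∣m+n 4∣v-vK 4∣vK))
          , ∣⇒∣ᵤ (F-mod8 _ ℓs refl even 4∣vK)
      where
      identity : ∀ x y → x ≡ (x - y) + y
      identity = solve-∀
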